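{- Let $n\ge 13$. The minimum number of queries in a non-adaptive algorithm that finds a pair of vertices at maximum distance in a hidden tree on $n$ vertices is $\frac{n(n-3)}{2}$, and the same holds for determining the hidden tree up to isomorphism. Moreover, for a query graph $Q$ on the $n$-element vertex set $V$, the following are equivalent: (i) $Q$ finds a pair of vertices at maximum distance; (ii) $Q$ determines the hidden tree up to isomorphism; (iii) every vertex of $Q$ has degree at least $n-3$.
   Context: A tree $T$ is hidden on a known vertex set $V$, $|V|=n$. A distance query is an unordered pair of distinct vertices, answered by their distance in $T$. A non-adaptive algorithm is a set $Q$ of queried pairs (the query graph on $V$) fixed in advance. A tree on $V$ is consistent if its distance between every pair in $Q$ equals the answer. $Q$ finds a pair of vertices at maximum distance if for every hidden tree $T$ there are vertices $x,y$ whose distance equals the diameter in every tree consistent with the answers of $T$ on $Q$. $Q$ determines the hidden tree up to isomorphism if for every hidden tree $T$ all trees consistent with the answers of $T$ on $Q$ are isomorphic. -}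

module Defs where

open import Data.Nat using (ℕ; zero; suc; _+_; _*_; _∸_; _≤_; _<ᵇ_)
open import Data.Nat.DivMod using (_/_)
open import Data.Fin using (Fin; zero; suc; toℕ; inject₁; fromℕ)
open import Data.Fin.Permutation using (Permutation′; _⟨$⟩ʳ_)
open import Data.Bool using (Bool; true; false; _∧_; if_then_else_)
open import Data.List using (List; map; allFin)
open import Data.Nat.ListAction using (sum)
open import Data.Product using (Σ; ∃; ∃-syntax; _×_; _,_)
open import Function.Definitions using (Injective)
open import Relation.Nullary using (¬_)
open import Relation.Binary.PropositionalEquality using (_≡_)

record SimpleGraph (n : ℕ) : Set where
  field
    adj     : Fin n → Fin n → Bool
    adj-sym : ∀ x y → adj x y ≡ adj y x
    adj-irr : ∀ x → adj x x ≡ false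
open SimpleGraph public

data Walk {n : ℕ} (G : SimpleGraph n) : Fin n → Fin n → ℕ → Set where
  here : ∀ {x} → Walk G x x zero
  step : ∀ {x y z k} → adj G x y ≡ true → Walk G y z k → Walk G x z (suc k)

Connected : ∀ {n} → SimpleGraph n → Set
Connected G = ∀ x y → ∃[ k ] Walk G x y k

HasCycle : ∀ {n} → SimpleGraph n → Set
HasCycle {n} G =
  ∃[ k ] Σ (Fin (suc (suc (suc k))) → Fin n) λ c →
    Injective _≡_ _≡_ c
    × (∀ (i : Fin (suc (suc k))) → adj G (c (inject₁ i)) (c (suc i)) ≡ true)
    × adj G (c (fromℕ (suc (suc k)))) (c zero) ≡ true

record Tree (n : ℕ) : Set where
  field
    graph     : SimpleGraph n
    connected : Connected graph
    acyclic   : ¬ HasCycle graph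
open Tree public

IsDist : ∀ {n} → Tree n → Fin n → Fin n → ℕ → Set
IsDist T x y d = Walk (graph T) x y d × (∀ k → Walk (graph T) x y k → d ≤ k)

IsDiamPair : ∀ {n} → Tree n → Fin n → Fin n → Set
IsDiamPair T x y = ∀ u v a b → IsDist T x y a → IsDist T u v b → b ≤ a

Isomorphic : ∀ {n} → Tree n → Tree n → Set
Isomorphic {n} T₁ T₂ =
  Σ (Permutation′ n) λ σ → ∀ x y → adj (graph T₂) (σ ⟨$⟩ʳ x) (σ ⟨$⟩ʳ y) ≡ adj (graph T₁) x y

QueryGraph : ℕ → Set
QueryGraph = SimpleGraph

-- T' is consistent with the answers of hidden tree T on the queries Q.
Consistent : ∀ {n} → QueryGraph n → Tree n → Tree n → Set
Consistent Q T T' = ∀ x y → adj Q x y ≡ true → ∀ d → IsDist T x y d → IsDist T' x y d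

FindsMaxPair : ∀ {n} → QueryGraph n → Set
FindsMaxPair {n} Q =
  ∀ (T : Tree n) → ∃[ x ] ∃[ y ] (∀ T' → Consistent Q T T' → IsDiamPair T' x y)

DeterminesIso : ∀ {n} → QueryGraph n → Set
DeterminesIso {n} Q =
  ∀ (T T₁ T₂ : Tree n) → Consistent Q T T₁ → Consistent Q T T₂ → Isomorphic T₁ T₂

degree : ∀ {n} → QueryGraph n → Fin n → ℕ
degree {n} Q v = sum (map (λ u → if adj Q v u then 1 else 0) (allFin n))

numQueries : ∀ {n} → QueryGraph n → ℕ
numQueries {n} Q =
  sum (map (λ i → sum (map (λ j → if adj Q i j ∧ (toℕ i <ᵇ toℕ j) then 1 else 0)
                           (allFin n)))
           (allFin n))

IsMinQueries : ∀ {n} → (QueryGraph n → Set) → ℕ → Set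
IsMinQueries {n} P m =
  (∃[ Q ] (P Q × numQueries Q ≡ m)) × (∀ Q → P Q → m ≤ numQueries Q)

MinDegreeAtLeast : ∀ {n} → QueryGraph n → ℕ → Set
MinDegreeAtLeast {n} Q k = ∀ (v : Fin n) → k ≤ degree Q v

{-# OPTIONS --safe #-}
module Submission where

-- Call a pair unqueried if it is not an edge of Q, and suppose that every vertex is in at most
-- two unqueried pairs.  Two trees consistent with the same answers have equal distances on all
-- other pairs, and as n ≥ 13 any four vertices admit a further vertex z that is queried together
-- with each of them.  Using z, every edge uv of one tree missing in the other comes from an
-- exchange: u and b are neighbours of a common vertex a in both trees, and v hangs at u in the
-- one tree and at b in the other.  Such an a has the same distances in both trees; rooted at a,
-- the parent functions f and g have equal kernels, and f x ≢ g x forces f x and g x to be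
-- siblings in both trees, so that transpositions of siblings conjugate f to g.  If the distance
-- of a diametral pair of a tree shrinks in a consistent one, an exchange lies on the shorter
-- path and yields a queried diametral pair; hence a pair at maximum distance is found.
-- Conversely, if v is unqueried with a, b and c, take a star at m with c hanging at its leaf a:
-- hanging v at a or at b changes none of the answers, but the diameter is 3 in one case and 4
-- in the other.

open import Defs
open import Data.Bool using (Bool; true; false; _∧_; _∨_; not; if_then_else_; T)
open import Data.Bool.Properties using (¬-not; ∨-comm; ∧-identityʳ; ∧-zeroʳ) renaming (_≟_ to _≟ᵇ_)
open import Data.Empty using (⊥; ⊥-elim)
open import Data.Fin using (Fin; zero; suc; toℕ; inject₁; fromℕ)
open import Data.Fin.Permutation using (Permutation′; _⟨$⟩ʳ_; _⟨$⟩ˡ_; inverseʳ; inverseˡ; transpose; _∘ₚ_) renaming (id to idₚ)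
open import Data.Fin.Properties using (_≟_; any?; pigeonhole; <⇒≢; toℕ-inject₁; toℕ-injective) renaming (suc-injective to suc-injectiveᶠ)
open import Data.Fin.Relation.Unary.Top using (view; view-fromℕ; view-inject₁; ‵fromℕ; ‵inject₁)
open import Data.List using (List; []; _∷_; map; allFin; tabulate; length; lookup)
open import Data.List.Properties using (map-tabulate)
import Data.List.Relation.Unary.All as All
open import Data.List.Relation.Unary.All using ([]; _∷_)
open import Data.List.Relation.Unary.AllPairs using ([]; _∷_)
open import Data.List.Relation.Unary.Unique.Propositional using (Unique)
open import Data.List.Membership.Propositional using (_∈_; _∉_)
open import Data.List.Membership.Propositional.Properties using (∈-allFin)
open import Data.List.Relation.Unary.Any.Properties using (lookup-index; ++⁺ˡ)
open import Data.List.Relation.Unary.Any using (here; there; index) renaming (any? to any∈?)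
open import Data.Nat using (ℕ; zero; suc; _+_; _*_; _∸_; _≤_; _<_; z≤n; s≤s; _≤?_; _<?_; _≤ᵇ_; _<ᵇ_)
open import Data.Nat.DivMod using (_/_; m*n/n≡m; /-monoˡ-≤)
open import Data.Nat.ListAction using (sum)
open import Data.Nat.Properties hiding (_≟_; <⇒≢)
open import Data.Nat.Properties using () renaming (_≟_ to _≟ⁿ_)
open import Data.Product using (Σ; ∃; ∃₂; ∃-syntax; _×_; _,_; proj₁; proj₂)
open import Data.Sum using (_⊎_; inj₁; inj₂; [_,_]′) renaming (swap to ⊎-swap)
open import Function using (_∘_; id; case_of_)
open import Function.Bundles using (_⇔_; mk⇔)
open import Function.Definitions using (Injective)
open import Relation.Binary.Definitions using (tri<; tri≈; tri>)
open import Relation.Nullary.Decidable using (_×-dec_; _⊎-dec_; ¬?; decidable-stable; dec-true; dec-false; does-⇔)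
open import Relation.Nullary using (¬_; Dec; does; yes; no; contradiction)
open import Relation.Binary.PropositionalEquality
open import Algebra.Properties.CommutativeMonoid.Sum +-0-commutativeMonoid using (∑-distrib-+; ∑-comm; sum-cong-≗; sum-replicate-zero) renaming (sum to ∑)

zero-or-suc : ∀ n → n ≡ 0 ⊎ ∃[ k ] n ≡ suc k
zero-or-suc zero    = inj₁ refl
zero-or-suc (suc k) = inj₂ (k , refl)

grows : ∀ k {n} → n ≢ suc (k + n)
grows k = m≢1+n+m _ {k}

add : ∀ k {m n} → m ≡ n → k + m ≡ k + n
add k = cong (k +_)

-- Trees as metric spaces

record TreeMetric (V : Set) : Set where
  field
    D      : V → V → ℕ
    D-refl : ∀ x → D x x ≡ 0
    D-eq   : ∀ {x y} → D x y ≡ 0 → x ≡ y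
    D-sym  : ∀ x y → D x y ≡ D y x
    D-tri  : ∀ x y z → D x z ≤ D x y + D y z

  infix 4 _~_
  _~_ : V → V → Set
  x ~ y = D x y ≡ 1

  field
    -- With the metric axioms these describe the distances of a tree: geodesics exist, adjacent
    -- vertices lie on different levels seen from any `z`, and the neighbour towards `z` is unique,
    -- which takes the place of acyclicity.
    D-next : ∀ {x y k} → D x y ≡ suc k → ∃[ w ] (x ~ w × D w y ≡ k)
    D-par  : ∀ {x y} → x ~ y → ∀ z → D z y ≡ suc (D z x) ⊎ D z x ≡ suc (D z y)
    D-uniq : ∀ {x y y′ z} → x ~ y → x ~ y′ → D z x ≡ suc (D z y) → D z x ≡ suc (D z y′) → y ≡ y′

  flip : ∀ {x y k} → D x y ≡ k → D y x ≡ k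
  flip {x} {y} = trans (D-sym y x)

  apart : ∀ {x y k} → D x y ≡ suc k → x ≢ y
  apart {x} e refl with () ← trans (sym e) (D-refl x)

  level : ∀ {x y z k} → x ~ y → D z x ≡ k → D z y ≡ suc k ⊎ k ≡ suc (D z y)
  level {z = z} xy refl = D-par xy z

  -- A path without backtracking that leaves z never returns.
  push : ∀ {x y w z k} → x ~ y → y ~ w → x ≢ w → D z x ≡ k → D z y ≡ suc k → D z w ≡ suc (suc k)
  push {z = z} xy yw x≢w refl e with D-par yw z
  ... | inj₁ up   = trans up (add 1 e)
  ... | inj₂ down = contradiction (D-uniq (flip xy) yw e down) x≢w

  dist₂ : ∀ {x y w} → x ~ y → y ~ w → x ≢ w → D x w ≡ 2
  dist₂ xy yw x≢w = push xy yw x≢w (D-refl _) xy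

  dist₃ : ∀ {x y w t} → x ~ y → y ~ w → w ~ t → x ≢ w → y ≢ t → D x t ≡ 3
  dist₃ xy yw wt x≢w y≢t = push yw wt y≢t xy (dist₂ xy yw x≢w)

  dist₄ : ∀ {x y w t s} → x ~ y → y ~ w → w ~ t → t ~ s →
          x ≢ w → y ≢ t → w ≢ s → D x s ≡ 4
  dist₄ xy yw wt ts x≢w y≢t w≢s = push wt ts w≢s (dist₂ xy yw x≢w) (dist₃ xy yw wt x≢w y≢t)

  between : ∀ {x y} → D x y ≡ 2 → ∃[ w ] (x ~ w × w ~ y)
  between = D-next

  -- Every step changes the parity of the distance from `z`, so two steps preserve it.
  even₂ : ∀ {x w y z} → x ~ w → w ~ y → D z y ≢ suc (D z x)
  even₂ {z = z} xw wy e with D-par xw z | D-par wy z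
  ... | inj₁ p | inj₁ q = grows 0 (trans (sym e) (trans q (add 1 p)))
  ... | inj₁ p | inj₂ q = grows 0 (trans (suc-injective (trans (sym p) q)) e)
  ... | inj₂ p | inj₁ q = grows 0 (trans (sym q) (trans e (add 1 p)))
  ... | inj₂ p | inj₂ q = grows 2 (trans e (add 1 (trans p (add 1 q))))

  separate : ∀ {x y z j k} → D x z ≡ j → D y z ≡ k → j ≢ k → x ≢ y
  separate p q j≢k refl = j≢k (trans (sym p) q)

  -- By `push`, the distance from `z` along a path first falls and then rises. A net gain of one
  -- over three steps means one fall and two rises, so the path turns at `a`.
  V-shape₃ : ∀ {u a b v z} → u ~ a → a ~ b → b ~ v → u ≢ b → a ≢ v →
             D z v ≡ suc (D z u) →
             D z u ≡ suc (D z a) × D z b ≡ suc (D z a) × D z v ≡ suc (suc (D z a))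
  V-shape₃ {u} {z = z} ua ab bv u≢b a≢v e with D-par ua z
  ... | inj₁ up = contradiction (trans (sym e) (push ab bv a≢v up (push ua ab u≢b refl up))) (grows 1)
  ... | inj₂ down with D-par ab z
  ...   | inj₁ up = down , up , trans e (cong suc down)
  ...   | inj₂ down′ with D-par bv z
  ...     | inj₁ up = contradiction (trans (sym up) (trans e (add 1 (trans down (add 1 down′))))) (grows 1)
  ...     | inj₂ down″ = contradiction (trans e (add 1 (trans down (add 1 (trans down′ (add 1 down″)))))) (grows 3)

  -- A net gain of one over five steps means two falls and three rises, so the path turns at `e`.
  -- The levels are stated relative to `a`, one step after the turn and two before `v`, as
  -- `grandparent` needs them.
  V-shape₅ : ∀ {u c e a b v z} → u ~ c → c ~ e → e ~ a → a ~ b → b ~ v →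
             u ≢ e → c ≢ a → e ≢ b → a ≢ v → D z v ≡ suc (D z u) →
             D z u ≡ suc (D z a) × D z v ≡ suc (suc (D z a))
  V-shape₅ {u} {c} {e} {a} {b} {v} {z} uc ce ea ab bv u≢e c≢a e≢b a≢v q with D-par uc z
  ... | inj₁ up = contradiction (trans (sym q) v≡) (grows 3)
    where
    e≡ = push uc ce u≢e refl up
    a≡ = push ce ea c≢a up e≡
    b≡ = push ea ab e≢b e≡ a≡
    v≡ = push ab bv a≢v a≡ b≡
  ... | inj₂ d₁ with D-par ce z
  ...   | inj₁ up = contradiction (trans (sym (trans q (add 1 d₁))) v≡) (grows 1)
    where
    a≡ = push ce ea c≢a refl up
    b≡ = push ea ab e≢b up a≡
    v≡ = push ab bv a≢v a≡ b≡
  ...   | inj₂ d₂ with D-par ea z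
  ...     | inj₁ up = u≡ , trans q (cong suc u≡)
    where
    u≡ : D z u ≡ suc (D z a)
    u≡ = trans d₁ (add 1 (trans d₂ (sym up)))
  ...     | inj₂ d₃ with trans q (add 1 (trans d₁ (add 1 (trans d₂ (cong suc d₃)))))
  ...       | v≡ with D-par ab z
  ...         | inj₁ up = contradiction (trans (sym (push ab bv a≢v refl up)) v≡) (grows 1)
  ...         | inj₂ d₄ with D-par bv z
  ...           | inj₁ up = contradiction (trans (sym up) (trans v≡ (add 4 d₄))) (grows 3)
  ...           | inj₂ d₅ = contradiction (trans v≡ (add 4 (trans d₄ (add 1 d₅)))) (grows 5)

  -- u is the neighbour of v towards z, so a vertex a two levels above v is adjacent to u.
  grandparent : ∀ {u v a z s} → D z a ≡ s → D z u ≡ suc s → D z v ≡ suc (suc s) →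
                u ~ v → D v a ≡ 2 → u ~ a
  grandparent {z = z} za zu zv uv va with between va
  ... | w , vw , wa with level (flip wa) za
  ...   | inj₁ zw = subst (_~ _) (D-uniq vw (flip uv) (trans zv (add 1 (sym zw))) (trans zv (add 1 (sym zu)))) wa
  ...   | inj₂ s≡ with level (flip vw) refl
  ...     | inj₁ up with () ← trans (sym zv) (trans up (sym s≡))
  ...     | inj₂ down = contradiction (trans down (add 1 (trans zv (add 2 s≡)))) (grows 3)

-- The configuration behind every edge uv of the first tree that the second one lacks:
-- the neighbours u and b of a have exchanged the subtree hanging at v.
record Exchange {V : Set} (M M′ : TreeMetric V) (H : V → V → Set) (u v a b : V) : Set where
  private
    module M  = TreeMetric M
    module M′ = TreeMetric M′
  field
    a~u  : a M.~ u
    u~v  : u M.~ v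
    a~b  : a M.~ b
    a~′u : a M′.~ u
    a~′b : a M′.~ b
    b~′v : b M′.~ v
    u≢b  : u ≢ b
    a≢v  : a ≢ v
    Hvu  : H v u
    Hvb  : H v b

Exchange-sym : ∀ {V M M′ H u v a b} → Exchange {V} M M′ H u v a b → Exchange M′ M H b v a u
Exchange-sym E = record
  { a~u = a~′b ; u~v = b~′v ; a~b = a~′u ; a~′u = a~b ; a~′b = a~u ; b~′v = u~v
  ; u≢b = u≢b ∘ sym ; a≢v = a≢v ; Hvu = Hvb ; Hvb = Hvu }
  where open Exchange E

-- z witnesses that a has further vertices behind it.
record Exchange⁺ {V : Set} (M M′ : TreeMetric V) (H : V → V → Set) (u v a b : V) : Set where
  field
    exchange : Exchange M M′ H u v a b
    z        : V
    z≢u      : z ≢ u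
    z≢b      : z ≢ b
    s        : ℕ
    zb       : TreeMetric.D M′ z b ≡ suc (suc s)
    zv       : TreeMetric.D M′ z v ≡ suc (suc (suc s))

-- H is the graph of unqueried pairs, of maximum degree two; two trees consistent
-- with the same answers have equal distances outside H.
record SparseRelation {V : Set} (H : V → V → Set) : Set where
  field
    H-sym : ∀ {x y} → H x y → H y x
    cap   : ∀ {x p q r} → H x p → H x q → p ≢ q → H x r → r ≡ p ⊎ r ≡ q

  -- With `v` and `e` the capacity of `u` would be exhausted, so `c` and `b` would both be
  -- H-neighbours of `v`, which together with `u` makes three.
  crowded : ∀ {u v c b e} → H u v → c ≢ b → H u c ⊎ H v c → H u b ⊎ H v b →
            c ≢ u → c ≢ v → b ≢ u → b ≢ v → e ≢ v → e ≢ c → e ≢ b → ¬ H u e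
  crowded {u} {v} {e = e} Huv c≢b Hc Hb c≢u c≢v b≢u b≢v e≢v e≢c e≢b Hue =
    [ c≢u ∘ sym , b≢u ∘ sym ]′ (cap (at-v c≢v e≢c Hc) (at-v b≢v e≢b Hb) c≢b (H-sym Huv))
    where
    at-v : ∀ {x} → x ≢ v → e ≢ x → H u x ⊎ H v x → H v x
    at-v x≢v e≢x (inj₁ h) = ⊥-elim ([ x≢v , e≢x ∘ sym ]′ (cap Huv Hue (e≢v ∘ sym) h))
    at-v x≢v e≢x (inj₂ h) = h

  outside : ∀ {x p q r} → H x p → H x q → p ≢ q → r ≢ p → r ≢ q → ¬ H x r
  outside Hp Hq p≢q r≢p r≢q Hr = [ r≢p , r≢q ]′ (cap Hp Hq p≢q Hr)

-- Distances to the centre of an exchange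

Agree : ∀ {V} → TreeMetric V → TreeMetric V → (V → V → Set) → Set
Agree M M′ H = ∀ x y → TreeMetric.D M x y ≡ TreeMetric.D M′ x y ⊎ H x y

Agree-sym : ∀ {V} {M M′ : TreeMetric V} {H} → Agree M M′ H → Agree M′ M H
Agree-sym ag x y with ag x y
... | inj₁ e = inj₁ (sym e)
... | inj₂ h = inj₂ h

module Compare {V : Set} (M M′ : TreeMetric V) {H : V → V → Set}
               (sparse : SparseRelation H) (agree : Agree M M′ H) where
  open TreeMetric M
  open TreeMetric M′ using () renaming
    ( D to D′; _~_ to _~′_; D-par to D′-par; flip to flip′; apart to apart′; level to level′
    ; push to push′; dist₂ to dist′₂; dist₃ to dist′₃; dist₄ to dist′₄; between to between′)
  open SparseRelation sparse

  same : ∀ {x y k} → ¬ H x y → D x y ≡ k → D′ x y ≡ k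
  same {x} {y} ¬h e with agree x y
  ... | inj₁ q = trans (sym q) e
  ... | inj₂ h = contradiction h ¬h

  same⁻ : ∀ {x y k} → ¬ H x y → D′ x y ≡ k → D x y ≡ k
  same⁻ {x} {y} ¬h e with agree x y
  ... | inj₁ q = trans q e
  ... | inj₂ h = contradiction h ¬h

  differ : ∀ {x y j k} → D x y ≡ j → D′ x y ≡ k → j ≢ k → H x y
  differ {x} {y} p q j≢k with agree x y
  ... | inj₁ e = contradiction (trans (sym p) (trans e q)) j≢k
  ... | inj₂ h = h

  module _ {u v a b} (E : Exchange M M′ H u v a b) where
    open Exchange E

    private
      u~a  = flip a~u
      v~u  = flip u~v
      b~′a = flip′ a~′b
      u~′a = flip′ a~′u
      v~′b = flip′ b~′v

      Huv = H-sym Hvu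
      Hbv = H-sym Hvb

    record Companion (y : V) : Set where
      field
        v~y  : v ~ y
        v~′y : v ~′ y
        y≢u  : y ≢ u
        y≢b  : y ≢ b
        Hyu  : H y u
        Hyb  : H y b
        yb   : D y b ≡ 4
        yu′  : D′ y u ≡ 4
        yb′  : D′ y b ≡ 2

    -- Every vertex of the first tree behind v is v itself or a leaf that moved along with v.
    behind-v : ∀ {y} → D y u ≡ suc (D y v) →
               y ≡ v ⊎ Companion y
    behind-v {y} yu with zero-or-suc (D v y)
    ... | inj₁ vy = inj₁ (sym (D-eq vy))
    ... | inj₂ (k , vy) with D-next vy
    ...   | y₁ , vy₁ , y₁y = inj₂ (conclude k y₁y vy)
      where
      y₁≢u : y₁ ≢ u
      y₁≢u refl with () ← trans (sym (flip y₁y)) (trans yu (add 1 (flip vy)))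
      y₁≢b : y₁ ≢ b
      y₁≢b refl with () ← trans (sym vy₁) (dist₃ v~u u~a a~b (a≢v ∘ sym) u≢b)
      vy₁′ : v ~′ y₁
      vy₁′ = same (outside Hvu Hvb u≢b y₁≢u y₁≢b) vy₁
      y₁b : D y₁ b ≡ 4
      y₁b = dist₄ (flip vy₁) v~u u~a a~b y₁≢u (a≢v ∘ sym) u≢b
      y₁u′ : D′ y₁ u ≡ 4
      y₁u′ = dist′₄ (flip′ vy₁′) v~′b b~′a a~′u y₁≢b (a≢v ∘ sym) (u≢b ∘ sym)
      y₁b′ : D′ y₁ b ≡ 2
      y₁b′ = dist′₂ (flip′ vy₁′) v~′b y₁≢b
      Hy₁u : H y₁ u
      Hy₁u = differ (dist₂ (flip vy₁) v~u y₁≢u) y₁u′ λ ()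
      Hy₁b : H y₁ b
      Hy₁b = differ y₁b y₁b′ λ ()
      v≢y₁ : v ≢ y₁
      v≢y₁ = apart vy₁
      conclude : ∀ k → D y₁ y ≡ k → D v y ≡ suc k → Companion y
      conclude zero y₁y vy with refl ← D-eq y₁y = record
        { v~y = vy₁ ; v~′y = vy₁′ ; y≢u = y₁≢u ; y≢b = y₁≢b ; Hyu = Hy₁u ; Hyb = Hy₁b
        ; yb = y₁b ; yu′ = y₁u′ ; yb′ = y₁b′ }
      -- Here `y` lies beyond `y₁`. The H-neighbours of `v` are `u` and `b`, those of `b` are `v`
      -- and `y₁`, so the distances from `y` to `v` and `b` are kept. They differ by three, although
      -- `b` and `v` are adjacent in the second tree.
      conclude (suc k) y₁y vy = ⊥-elim absurd
        where
        y≢v : y ≢ v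
        y≢v = apart (flip vy)
        y≢y₁ : y ≢ y₁
        y≢y₁ = apart (flip y₁y)
        yu₁ : D y u ≡ suc (suc (suc k))
        yu₁ = trans yu (add 1 (flip vy))
        ya : D y a ≡ suc (suc (suc (suc k)))
        ya = push v~u u~a (a≢v ∘ sym) (flip vy) yu₁
        yb : D y b ≡ suc (suc (suc (suc (suc k))))
        yb = push u~a a~b u≢b yu₁ ya
        yv′ : D′ y v ≡ suc (suc k)
        yv′ = same (outside Hvu Hvb u≢b (apart yu₁) (apart yb) ∘ H-sym) (flip vy)
        yb′ : D′ y b ≡ suc (suc (suc (suc (suc k))))
        yb′ = same (outside Hbv (H-sym Hy₁b) v≢y₁ y≢v y≢y₁ ∘ H-sym) yb
        absurd : ⊥
        absurd with D′-par b~′v y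
        ... | inj₁ up with () ← trans (sym yv′) (trans up (cong suc yb′))
        ... | inj₂ down with () ← trans (sym yb′) (trans down (cong suc yv′))

    -- Apart from `u` and the vertices covered by `behind-v`, `x` is reached from `u` through a
    -- neighbour `y` other than `a` and `v`. The distance two between `y` and `v` is kept, and their
    -- common neighbour in the second tree can only be `b`, so `y` has moved from `u` to `b` as
    -- well. Every further `x` then keeps its distances to `u` and `b`, which determine the one to
    -- `a`.
    below-u : ∀ {x} → D x a ≡ suc (D x u) → D x a ≡ D′ x a
    below-u {x} xa with D-par u~v x
    ... | inj₂ xu with behind-v xu
    ...   | inj₁ refl = trans (dist₂ v~u u~a (a≢v ∘ sym)) (sym (dist′₂ v~′b b~′a (a≢v ∘ sym)))
    ...   | inj₂ C =
      trans (dist₃ (flip v~y) v~u u~a y≢u (a≢v ∘ sym)) (sym (dist′₃ (flip′ v~′y) v~′b b~′a y≢b (a≢v ∘ sym)))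
      where open Companion C
    below-u {x} xa | inj₁ xv with zero-or-suc (D u x)
    ... | inj₁ ux with refl ← D-eq ux = trans u~a (sym u~′a)
    ... | inj₂ (k , ux) with D-next ux
    ...   | y , uy , yx = conclude
      where
      xu : D x u ≡ suc k
      xu = flip ux
      xa₁ : D x a ≡ suc (suc k)
      xa₁ = trans xa (cong suc xu)
      xb₁ : D x b ≡ suc (suc (suc k))
      xb₁ = push u~a a~b u≢b xu xa₁
      y~u = flip uy
      y≢v : y ≢ v
      y≢v refl with () ← trans (sym (flip yx)) (trans xv (cong suc xu))
      y≢a : y ≢ a
      y≢a refl with () ← trans (sym (flip yx)) xa₁
      yv : D y v ≡ 2
      yv = dist₂ y~u u~v y≢v
      ya : D y a ≡ 2
      ya = dist₂ y~u u~a y≢a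
      yb : D y b ≡ 3
      yb = dist₃ y~u u~a a~b y≢a u≢b
      yv′ : D′ y v ≡ 2
      yv′ = same (outside Hvu Hvb u≢b (apart y~u) (apart yb) ∘ H-sym) yv
      conclude : D x a ≡ D′ x a
      conclude with between′ (flip′ yv′)
      ... | y′ , vy′ , y′y with agree v y′
      -- A vertex `y′` adjacent to `v` in both trees would give `u` three H-neighbours: `v`, `y` and
      -- `y′`.
      ...   | inj₁ e = contradiction (cap Huv Huy (y≢v ∘ sym) (H-sym Hy′u)) [ y′≢v , y′≢y ]′
        where
        v~y′ = trans e vy′
        y′≢v : y′ ≢ v
        y′≢v = apart (flip v~y′)
        y′≢y : y′ ≢ y
        y′≢y = apart′ y′y
        y′≢u : y′ ≢ u
        y′≢u refl with () ← trans (sym vy′) (dist′₃ v~′b b~′a a~′u (a≢v ∘ sym) (u≢b ∘ sym))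
        y′≢b : y′ ≢ b
        y′≢b refl with () ← trans (sym v~y′) (dist₃ v~u u~a a~b (a≢v ∘ sym) u≢b)
        Hy′u : H y′ u
        Hy′u = differ (dist₂ (flip v~y′) v~u y′≢u)
                      (dist′₄ (flip′ vy′) v~′b b~′a a~′u y′≢b (a≢v ∘ sym) (u≢b ∘ sym)) λ ()
        ya′ : D′ y a ≡ 4
        ya′ = dist′₄ (flip′ y′y) (flip′ vy′) v~′b b~′a y≢v y′≢b (a≢v ∘ sym)
        Huy : H u y
        Huy = H-sym (differ y~u (push′ b~′a a~′u (u≢b ∘ sym)
                     (dist′₃ (flip′ y′y) (flip′ vy′) v~′b y≢v y′≢b) ya′) λ ())
      ...   | inj₂ h with cap Hvu Hvb u≢b h
      ...     | inj₁ refl with () ← trans (sym vy′) (dist′₃ v~′b b~′a a~′u (a≢v ∘ sym) (u≢b ∘ sym))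
      ...     | inj₂ refl = final k refl
        where
        y~′b = flip′ y′y
        Hyb : H y b
        Hyb = differ yb y~′b λ ()
        Hyu : H y u
        Hyu = differ y~u (dist′₃ y~′b b~′a a~′u y≢a (u≢b ∘ sym)) λ ()
        final : ∀ j → j ≡ k → D x a ≡ D′ x a
        final zero refl with refl ← D-eq yx = trans ya (sym (dist′₂ y~′b b~′a y≢a))
        final (suc j) refl = trans xa₁ (sym xa′)
          where
          x≢v : x ≢ v
          x≢v = apart (trans xv (cong suc xu))
          x≢y : x ≢ y
          x≢y = apart (flip yx)
          xu′ : D′ x u ≡ suc k
          xu′ = same (outside Huv (H-sym Hyu) (y≢v ∘ sym) x≢v x≢y ∘ H-sym) xu
          xb′ : D′ x b ≡ suc (suc (suc k))
          xb′ = same (outside Hbv (H-sym Hyb) (y≢v ∘ sym) x≢v x≢y ∘ H-sym) xb₁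
          xa′ : D′ x a ≡ suc (suc k)
          xa′ with level′ u~′a xu′
          ... | inj₁ up = up
          ... | inj₂ k≡ with D′-par a~′b x
          ...   | inj₁ up with () ← trans (sym xb′) (trans up (sym k≡))
          ...   | inj₂ down with () ← trans k≡ (add 1 (trans down (cong suc xb′)))

module _ {V : Set} (M M′ : TreeMetric V) {H : V → V → Set}
         (sparse : SparseRelation H) (agree : Agree M M′ H) where
  open TreeMetric M
  open TreeMetric M′ using () renaming
    (D to D′; D-par to D′-par; push to push′)
  open SparseRelation sparse

  -- `below-u` settles the branch of `u` in the first tree and, by symmetry, that of `b` in the
  -- second. Any other `x` reaches `v` through `a` in both trees, two steps further, so agreement on
  -- `x`, `v` gives agreement on `x`, `a`. If `x`, `v` is an H-pair, `x` is `u` or `b`, a neighbour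
  -- of `a` in both trees.
  exchange⇒hub : ∀ {u v a b} → Exchange M M′ H u v a b → ∀ x → D x a ≡ D′ x a
  exchange⇒hub {u} {v} {a} {b} E x with D-par (Exchange.a~u E) x | D′-par (Exchange.a~′b E) x
  ... | inj₂ xa | _        = Compare.below-u M M′ sparse agree E xa
  ... | inj₁ _  | inj₂ xa′ =
    sym (Compare.below-u M′ M sparse (Agree-sym {M = M} {M′} agree) (Exchange-sym E) xa′)
  ... | inj₁ xu | inj₁ xb′ with agree x v
  ...   | inj₁ e = suc-injective (suc-injective
                     (trans (sym (push a~u u~v a≢v refl xu)) (trans e (push′ a~′b b~′v a≢v refl xb′))))
    where open Exchange E
  ...   | inj₂ h with cap (Exchange.Hvu E) (Exchange.Hvb E) (Exchange.u≢b E) (H-sym h)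
  ...     | inj₁ refl = trans (flip a~u) (sym (TreeMetric.flip M′ a~′u))
    where open Exchange E
  ...     | inj₂ refl = trans (flip a~b) (sym (TreeMetric.flip M′ a~′b))
    where open Exchange E

-- Finding an exchange at a lost edge

Far : {V : Set} → (V → V → Set) → V → V → Set
Far H z x = z ≢ x × ¬ H z x

Avoiding : {V : Set} → (V → V → Set) → Set
Avoiding H = ∀ a b c d → ∃[ z ] (Far H z a × Far H z b × Far H z c × Far H z d)

module FindExchange {V : Set} (M M′ : TreeMetric V) {H : V → V → Set}
                    (sparse : SparseRelation H) (agree : Agree M M′ H) (avoid : Avoiding H) where
  open TreeMetric M
  open TreeMetric M′ using () renaming
    ( D to D′; _~_ to _~′_; D-eq to D′-eq; D-next to D′-next; flip to flip′; apart to apart′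
    ; dist₂ to dist′₂; dist₃ to dist′₃; between to between′; even₂ to even′₂; separate to separate′
    ; V-shape₃ to V-shape′₃; V-shape₅ to V-shape′₅)
  open SparseRelation sparse
  open Compare M M′ sparse agree

  -- Seen from `z`, the path of the second tree turns at `a`, and `z` carries these levels over to
  -- the first tree. There `v` has only one neighbour towards `z`, so `b` is not adjacent to it;
  -- `grandparent` yields the edge `ua`, and if `a`, `b` is an H-pair, the edge `ab` comes from the
  -- uniqueness of the neighbour of `u` towards `z`.
  exchange₃ : ∀ {u v a b z} → u ~ v → u ~′ a → a ~′ b → b ~′ v → u ≢ b → a ≢ v →
              Far H z u → Far H z v → Far H z a → Far H z b → D z v ≡ suc (D z u) →
              Exchange⁺ M M′ H u v a b
  exchange₃ {u} {v} {a} {b} {z} uv ua′ ab′ bv′ u≢b a≢v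
            (z≢u , ¬zu) (z≢v , ¬zv) (z≢a , ¬za) (z≢b , ¬zb) e = conclude (zero-or-suc s)
    where
    s = D′ z a
    shape = V-shape′₃ ua′ ab′ bv′ u≢b a≢v (trans (same ¬zv e) (add 1 (sym (same ¬zu refl))))
    za : D z a ≡ s
    za = same⁻ ¬za refl
    zu : D z u ≡ suc s
    zu = same⁻ ¬zu (proj₁ shape)
    zb : D z b ≡ suc s
    zb = same⁻ ¬zb (proj₁ (proj₂ shape))
    zv : D z v ≡ suc (suc s)
    zv = same⁻ ¬zv (proj₂ (proj₂ shape))
    Hvu : H v u
    Hvu = H-sym (differ uv (dist′₃ ua′ ab′ bv′ u≢b a≢v) λ ())
    Hvb : H v b
    Hvb with agree v b
    ... | inj₂ h = h
    ... | inj₁ q = contradiction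
      (D-uniq (flip uv) (trans q (flip′ bv′)) e (trans zv (add 1 (sym zb)))) u≢b
    ua : u ~ a
    ua = grandparent za zu zv uv
      (same⁻ (outside Hvu Hvb u≢b (apart′ (flip′ ua′)) (apart′ ab′)) (dist′₂ (flip′ bv′) (flip′ ab′) (a≢v ∘ sym)))
    ab : a ~ b
    ab with agree a b
    ... | inj₁ q = trans q ab′
    ... | inj₂ Hab with between (same⁻ (outside (H-sym Hab) (H-sym Hvb) a≢v (apart ua) (apart uv) ∘ H-sym)
                                       (dist′₂ ua′ ab′ u≢b))
    ...   | w , uw , wb with level uw zu
    ...     | inj₁ zw = contradiction (trans (sym zb) (push uw wb u≢b zu zw)) (grows 1)
    ...     | inj₂ zw = subst (_~ b) (D-uniq uw ua (trans zu zw) (trans zu (add 1 (sym za)))) wb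
    conclude : s ≡ 0 ⊎ (∃[ k ] s ≡ suc k) → Exchange⁺ M M′ H u v a b
    conclude (inj₁ s≡0)       = contradiction (D′-eq s≡0) z≢a
    -- As `z` is not `a`, their distance is positive; the field `s` is one less than this distance.
    conclude (inj₂ (k , s≡k)) = record
      { exchange = record
          { a~u = flip ua ; u~v = uv ; a~b = ab ; a~′u = flip′ ua′ ; a~′b = ab′ ; b~′v = bv′
          ; u≢b = u≢b ; a≢v = a≢v ; Hvu = Hvu ; Hvb = Hvb }
      ; z = z ; z≢u = z≢u ; z≢b = z≢b ; s = k
      ; zb = trans (proj₁ (proj₂ shape)) (add 1 s≡k)
      ; zv = trans (proj₂ (proj₂ shape)) (add 2 s≡k) }

  -- `c` and `b` are the neighbours of `u` and `v` on the path of the second tree. Each is at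
  -- distance one from one end and at least three from the other, which the edge `uv` rules out in
  -- the first tree, so each is H-related to an end. By `crowded` the inner vertices `e` and `a`
  -- then keep their distances to both ends.
  ¬stretch₄ : ∀ {u v k} → u ~ v → D′ u v ≢ suc (suc (suc (suc k)))
  ¬stretch₄ {u} {v} {k} uv uv′
    with c , uc , cv ← D′-next uv′
    with e , ce , ev ← D′-next cv
    with a , ea , av ← D′-next ev
    with b , vb , bu ← D′-next (flip′ uv′) = absurd
    where
    squeezed : ∀ {x p q} → p ~ q → D′ x p ≡ 1 → D′ x q ≡ suc (suc (suc k)) → H p x ⊎ H q x
    squeezed {x} {p} {q} pq xp xq with agree x p | agree x q
    ... | inj₂ h | _      = inj₁ (H-sym h)
    ... | inj₁ _ | inj₂ h = inj₂ (H-sym h)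
    ... | inj₁ i | inj₁ j with level pq (trans i xp)
    ...   | inj₁ up with () ← trans (sym up) (trans j xq)
    ...   | inj₂ down with () ← trans down (add 1 (trans j xq))

    Huv : H u v
    Huv = differ uv uv′ λ ()
    Hc : H u c ⊎ H v c
    Hc = squeezed uv (flip′ uc) cv
    Hb : H u b ⊎ H v b
    Hb = ⊎-swap (squeezed (flip uv) (flip′ vb) bu)
    c≢b : c ≢ b
    c≢b = separate′ cv (flip′ vb) λ ()
    c≢u = apart′ (flip′ uc)
    c≢v = apart′ cv
    b≢u = apart′ bu
    b≢v = apart′ (flip′ vb)

    safe : ∀ {x} → x ≢ u → x ≢ v → x ≢ c → x ≢ b → ¬ H x u × ¬ H x v
    safe x≢u x≢v x≢c x≢b =
      crowded Huv c≢b Hc Hb c≢u c≢v b≢u b≢v x≢v x≢c x≢b ∘ H-sym ,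
      crowded (H-sym Huv) c≢b (⊎-swap Hc) (⊎-swap Hb) c≢v c≢u b≢v b≢u x≢u x≢c x≢b ∘ H-sym

    u≢e : u ≢ e
    u≢e = separate′ uv′ ev λ ()
    ue′ : D′ u e ≡ 2
    ue′ = dist′₂ uc ce u≢e
    safe-e = safe (u≢e ∘ sym) (apart′ ev) (apart′ (flip′ ce)) (separate′ (flip′ ue′) bu λ ())
    eu : D e u ≡ 2
    eu = same⁻ (proj₁ safe-e) (flip′ ue′)
    ev₁ : D e v ≡ suc (suc k)
    ev₁ = same⁻ (proj₂ safe-e) ev

    -- The path in the second tree now is u c e a b₂ v.
    stretch₅ : k ≡ 1 → ⊥
    stretch₅ refl
      with b₂ , ab₂ , b₂v ← D′-next av
      with z , (_ , ¬zu) , (_ , ¬zv) , (_ , ¬za) , (_ , ¬ze) ← avoid u v a e = orient (D-par uv z)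
      where
      c≢a : c ≢ a
      c≢a = separate′ cv av λ ()
      e≢b₂ : e ≢ b₂
      e≢b₂ = separate′ ev b₂v λ ()
      a≢v : a ≢ v
      a≢v = apart′ av
      safe-a = safe (separate′ av uv′ λ ()) a≢v (c≢a ∘ sym) (separate′ av (flip′ vb) λ ())
      au : D a u ≡ 3
      au = same⁻ (proj₁ safe-a) (flip′ (dist′₃ uc ce ea u≢e c≢a))
      va : D v a ≡ 2
      va = flip (same⁻ (proj₂ safe-a) av)
      -- Seen from `z`, either `a` is two levels above `v` or, on the reversed path, `e` is two
      -- levels above `u`. `grandparent` makes the other end of the edge `uv` adjacent to it,
      -- although their distance is three.
      orient : D z v ≡ suc (D z u) ⊎ D z u ≡ suc (D z v) → ⊥
      orient (inj₁ zv) = case trans (sym (flip au)) (grandparent (same⁻ ¬za refl)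
          (same⁻ ¬zu (proj₁ shape)) (same⁻ ¬zv (proj₂ shape)) uv va) of λ ()
        where
        shape = V-shape′₅ uc ce ea ab₂ b₂v u≢e c≢a e≢b₂ a≢v (trans (same ¬zv zv) (add 1 (sym (same ¬zu refl))))
      orient (inj₂ zu) = case trans (sym (flip ev₁)) (grandparent (same⁻ ¬ze refl)
          (same⁻ ¬zv (proj₁ shape)) (same⁻ ¬zu (proj₂ shape)) (flip uv) (flip eu)) of λ ()
        where
        shape = V-shape′₅ (flip′ b₂v) (flip′ ab₂) (flip′ ea) (flip′ ce) (flip′ uc)
          (a≢v ∘ sym) (e≢b₂ ∘ sym) (c≢a ∘ sym) (u≢e ∘ sym) (trans (same ¬zu zu) (add 1 (sym (same ¬zv refl))))

    absurd : ⊥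
    -- `e` has distances two and `k + 2` to `u` and `v` in both trees. They differ by one across the
    -- edge `uv`, which leaves only `k ≡ 1`.
    absurd with level uv eu
    ... | inj₁ q = stretch₅ (suc-injective (suc-injective (trans (sym ev₁) q)))
    ... | inj₂ q with () ← trans q (add 1 ev₁)

  Found : V → V → Set
  Found u v = ∃₂ λ a b → Exchange⁺ M M′ H u v a b

  -- Distance two in the second tree is excluded by parity as seen from `z`, and four or more by
  -- `¬stretch₄`. At distance three, whichever of `u` and `v` is farther from `z` is the vertex that
  -- moves.
  find-exchange : ∀ {u v} → u ~ v → ¬ (u ~′ v) → Found u v ⊎ Found v u
  find-exchange {u} {v} uv ¬uv′ = cases (D′ u v) refl
    where
    cases : ∀ k → D′ u v ≡ k → Found u v ⊎ Found v u
    cases 0 uv′ = contradiction (D′-eq uv′) (apart uv)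
    cases 1 uv′ = contradiction uv′ ¬uv′
    cases 2 uv′
      with w , uw , wv ← between′ uv′
      with z , (_ , ¬zu) , (_ , ¬zv) , _ ← avoid u v w w
      with D-par uv z
    ... | inj₁ zv = contradiction (trans (same ¬zv zv) (add 1 (sym (same ¬zu refl)))) (even′₂ uw wv)
    ... | inj₂ zu = contradiction (trans (same ¬zu zu) (add 1 (sym (same ¬zv refl)))) (even′₂ (flip′ wv) (flip′ uw))
    cases 3 uv′
      with a , ua , av ← D′-next uv′
      with b , ab , bv ← D′-next av
      with z , fu , fv , fa , fb ← avoid u v a b
      with D-par uv z
    ... | inj₁ zv = inj₁ (a , b , exchange₃ uv ua ab bv (separate′ uv′ bv λ ()) (apart′ av) fu fv fa fb zv)
    ... | inj₂ zu = inj₂ (b , a , exchange₃ (flip uv) (flip′ bv) (flip′ ab) (flip′ ua)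
                            (apart′ av ∘ sym) (separate′ bv uv′ λ ()) fv fu fb fa zu)
    cases (suc (suc (suc (suc k)))) uv′ = contradiction uv′ (¬stretch₄ uv)

-- Parent functions of two trees with a common root

module Rooted {V : Set} (M : TreeMetric V) (r : V) where
  open TreeMetric M

  parent : V → V
  parent x with zero-or-suc (D x r)
  ... | inj₁ _       = x
  ... | inj₂ (_ , e) = proj₁ (D-next e)

  parent-root : parent r ≡ r
  parent-root with zero-or-suc (D r r)
  ... | inj₁ _       = refl
  ... | inj₂ (_ , e) = contradiction refl (apart e)

  parent-step : ∀ {x k} → D r x ≡ suc k → x ~ parent x × D r (parent x) ≡ k
  parent-step {x} e with zero-or-suc (D x r)
  ... | inj₁ q with () ← trans (sym (flip q)) e
  ... | inj₂ (_ , q) with D-next q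
  ...   | w , xw , wr = xw , trans (flip wr) (suc-injective (trans (sym (flip q)) e))

  parent-unique : ∀ {x y} → x ~ y → D r x ≡ suc (D r y) → parent x ≡ y
  parent-unique xy e with parent-step e
  ... | xp , q = D-uniq xp xy (trans e (add 1 (sym q))) e

-- For two parent functions f and g, either value of a vertex with f x ≢ g x
-- has the same parent under both.
CommonGrandparent : {V : Set} → (V → V) → (V → V) → V → Set
CommonGrandparent f g x = f (f x) ≡ g (f x) × f (f x) ≡ f (g x) × f (f x) ≡ g (g x)

module SharedRoot {V : Set} (M M′ : TreeMetric V) {H : V → V → Set}
                  (sparse : SparseRelation H) (agree : Agree M M′ H) (avoid : Avoiding H)
                  (r : V) (hub : ∀ x → TreeMetric.D M r x ≡ TreeMetric.D M′ r x) where
  open TreeMetric M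
  open TreeMetric M′ using () renaming
    (D to D′; flip to flip′; D-uniq to D′-uniq; level to level′; push to push′; between to between′)
  open SparseRelation sparse
  open Compare M M′ sparse agree
  open FindExchange M M′ sparse agree avoid
  open Rooted M r renaming (parent to f; parent-root to f-root; parent-step to f-step; parent-unique to f-unique)
  open Rooted M′ r renaming (parent to g; parent-root to g-root; parent-unique to g-unique)

  private
    to : ∀ {x k} → D r x ≡ k → D′ r x ≡ k
    to = trans (sym (hub _))

    from : ∀ {x k} → D′ r x ≡ k → D r x ≡ k
    from = trans (hub _)

  record Moved (x : V) : Set where
    field
      grand  : CommonGrandparent f g x
      {k}    : ℕ
      rx     : D r x ≡ suc (suc k)
      r-f    : D r (f x) ≡ suc k
      r-g    : D r (g x) ≡ suc k
      f≢g    : f x ≢ g x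
      Hf     : H x (f x)
      Hg     : H x (g x)

  -- As depths agree, `f x ≢ g x` means that the edge from `x` to `f x` is lost. In the exchange
  -- there, `a` must be the common parent of `f x` and `b`: any other position makes an edge of the
  -- second tree join depths that do not differ by one, or gives `b` two parents in it.
  moved : ∀ {x} → f x ≢ g x → Moved x
  moved {x} fx≢gx with zero-or-suc (D r x)
  ... | inj₁ rx with refl ← D-eq rx = contradiction (trans f-root (sym g-root)) fx≢gx
  ... | inj₂ (k , rx) with f-step rx
  ...   | xu , ru with find-exchange (flip xu) (λ u~′x →
                      fx≢gx (sym (g-unique (flip′ u~′x) (trans (to rx) (add 1 (sym (to ru)))))))
  ...     | inj₂ (a , b , E⁺) = ⊥-elim absurd
    where
    open Exchange (Exchange⁺.exchange E⁺)
    ra : D r a ≡ suc (suc k)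
    ra = push (flip xu) (flip a~u) (a≢v ∘ sym) ru rx
    rb : D r b ≡ suc (suc (suc k))
    rb = push (flip a~u) a~b u≢b rx ra
    absurd : ⊥
    absurd with level′ b~′v (to rb)
    ... | inj₁ up with () ← trans (sym (to ru)) up
    ... | inj₂ down with () ← trans down (add 1 (to ru))
  ...     | inj₁ (a , b , E⁺) = conclude (level (flip a~u) ru)
    where
    open Exchange (Exchange⁺.exchange E⁺)
    conclude : D r a ≡ suc k ⊎ k ≡ suc (D r a) → Moved x
    conclude (inj₁ ra) = contradiction
      (D′-uniq b~′v (flip′ a~′b) (trans (to rb) (add 1 (sym (to rx)))) (trans (to rb) (add 1 (sym (to ra)))))
      (a≢v ∘ sym)
      where
      rb : D r b ≡ suc (suc k)
      rb = push (flip a~u) a~b u≢b ru ra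
    conclude (inj₂ k≡) with level a~b refl
    ... | inj₂ a≡ = ⊥-elim absurd
      where
      absurd : ⊥
      absurd with level′ b~′v (to refl)
      ... | inj₁ up = contradiction (trans (sym up) (trans (to rx) (add 1 (trans k≡ (add 1 a≡))))) (grows 1)
      ... | inj₂ down = contradiction (trans down (add 1 (trans (to rx) (add 1 (trans k≡ (add 1 a≡)))))) (grows 3)
    ... | inj₁ rb = record
      { grand = trans fu (sym gu) , trans fu (trans (sym fb) (cong f (sym gx)))
              , trans fu (trans (sym gb) (cong g (sym gx)))
      ; rx = trans rx (add 1 k≡) ; r-f = trans ru k≡ ; r-g = trans (cong (D r) gx) rb
      ; f≢g = fx≢gx ; Hf = Hvu ; Hg = subst (H x) (sym gx) Hvb }
      where
      gx : g x ≡ b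
      gx = g-unique (flip′ b~′v) (trans (to rx) (add 1 (trans k≡ (sym (to rb)))))
      fu : f (f x) ≡ a
      fu = f-unique (flip a~u) (trans ru k≡)
      gu : g (f x) ≡ a
      gu = g-unique (flip′ a~′u) (trans (to ru) (trans k≡ (add 1 (hub a))))
      fb : f b ≡ a
      fb = f-unique (flip a~b) rb
      gb : g b ≡ a
      gb = g-unique (flip′ a~′b) (trans (to rb) (add 1 (hub a)))

  -- Two children of f x are at distance two, and y is no H-neighbour of x,
  -- so they stay siblings in the second tree.
  moved-siblings : ∀ {x y} → Moved x → x ≢ y → f x ≡ f y → g x ≡ g y
  moved-siblings {x} {y} Mx x≢y fx≡fy with zero-or-suc (D r y)
  ... | inj₁ ry with refl ← D-eq ry
                with () ← trans (sym (D-refl r)) (trans (cong (D r) (trans (sym f-root) (sym fx≡fy))) (Moved.r-f Mx))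
  ... | inj₂ (j , ry) = conclude
    where
    open Moved Mx
    ry₁ : D r y ≡ suc (suc k)
    ry₁ = trans ry (add 1 (trans (sym (proj₂ (f-step ry))) (trans (cong (D r) (sym fx≡fy)) r-f)))
    xy : D x y ≡ 2
    xy = dist₂ (proj₁ (f-step rx)) (subst (_~ y) (sym fx≡fy) (flip (proj₁ (f-step ry)))) x≢y
    xy′ : D′ x y ≡ 2
    xy′ = same (outside Hf Hg f≢g (separate (flip ry₁) (flip r-f) λ ()) (separate (flip ry₁) (flip r-g) λ ())) xy
    conclude : g x ≡ g y
    conclude with between′ xy′
    ... | w , xw , wy with level′ xw (to rx)
    ...   | inj₁ rw with () ← trans (sym (to ry₁)) (push′ xw wy x≢y (to rx) rw)
    ...   | inj₂ e = trans (g-unique xw (trans (to rx) e)) (sym (g-unique (flip′ wy) (trans (to ry₁) e)))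

-- Conjugating parent functions by transpositions

module _ {n : ℕ} (u w : Fin n) where

  private
    σ : Fin n → Fin n
    σ k = transpose u w ⟨$⟩ʳ k

  transpose-cases : ∀ k → (k ≡ u × σ k ≡ w) ⊎ (k ≡ w × σ k ≡ u) ⊎ (k ≢ u × k ≢ w × σ k ≡ k)
  transpose-cases k with k ≟ u
  ... | yes k≡u = inj₁ (k≡u , refl)
  ... | no k≢u with k ≟ w
  ...   | yes k≡w = inj₂ (inj₁ (k≡w , refl))
  ...   | no k≢w  = inj₂ (inj₂ (k≢u , k≢w , refl))

  transpose-fixed : ∀ {k} → k ≢ u → k ≢ w → σ k ≡ k
  transpose-fixed {k} k≢u k≢w with transpose-cases k
  ... | inj₁ (k≡u , _)               = contradiction k≡u k≢u
  ... | inj₂ (inj₁ (k≡w , _))        = contradiction k≡w k≢w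
  ... | inj₂ (inj₂ (_ , _ , σk≡k))   = σk≡k

  transpose-right : σ w ≡ u
  transpose-right with transpose-cases w
  ... | inj₁ (w≡u , σw≡w)          = trans σw≡w w≡u
  ... | inj₂ (inj₁ (_ , σw≡u))     = σw≡u
  ... | inj₂ (inj₂ (_ , w≢w , _))  = contradiction refl w≢w

  transpose-involutive : ∀ k → σ (σ k) ≡ k
  transpose-involutive k with transpose-cases k
  ... | inj₁ (k≡u , σk≡w)        = trans (cong σ σk≡w) (trans transpose-right (sym k≡u))
  ... | inj₂ (inj₂ (_ , _ , e))  = trans (cong σ e) e
  ... | inj₂ (inj₁ (k≡w , σk≡u)) with transpose-cases u
  ...   | inj₁ (_ , σu≡w)           = trans (cong σ σk≡u) (trans σu≡w (sym k≡w))
  ...   | inj₂ (inj₁ (u≡w , σu≡u))  = trans (cong σ σk≡u) (trans σu≡u (trans u≡w (sym k≡w)))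
  ...   | inj₂ (inj₂ (u≢u , _))     = contradiction refl u≢u

  transpose-invariant : {A : Set} (F : Fin n → A) → F u ≡ F w → ∀ k → F (σ k) ≡ F k
  transpose-invariant F e k with transpose-cases k
  ... | inj₁ (k≡u , σk≡w)         = trans (cong F σk≡w) (trans (sym e) (cong F (sym k≡u)))
  ... | inj₂ (inj₁ (k≡w , σk≡u))  = trans (cong F σk≡u) (trans e (cong F (sym k≡w)))
  ... | inj₂ (inj₂ (_ , _ , σk≡k)) = cong F σk≡k

-- If f x ≢ g x, composing g with the transposition of f x and g x repairs x, spoils
-- no other vertex, and conjugates g, since f x and g x have the same image under g.
conjugate : ∀ {n} (xs : List (Fin n)) (f g : Fin n → Fin n) →
            (∀ {x y} → f x ≡ f y → g x ≡ g y) → (∀ {x y} → g x ≡ g y → f x ≡ f y) →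
            (∀ {x} → f x ≢ g x → CommonGrandparent f g x) →
            (∀ {x} → f x ≢ g x → x ∈ xs) →
            Σ (Permutation′ n) λ π → ∀ x → π ⟨$⟩ʳ f x ≡ g (π ⟨$⟩ʳ x)
conjugate [] f g _ _ _ bad = idₚ , equal
  where
  equal : ∀ x → f x ≡ g x
  equal x with f x ≟ g x
  ... | yes e = e
  ... | no ne with () ← bad ne
conjugate (x ∷ xs) f g f⇒g g⇒f grand bad with f x ≟ g x
... | yes e = conjugate xs f g f⇒g g⇒f grand λ {y} ne → tail-of ne (bad ne)
  where
  tail-of : ∀ {y} → f y ≢ g y → y ∈ x ∷ xs → y ∈ xs
  tail-of ne (here refl) = contradiction e ne
  tail-of ne (there p)   = p
... | no ne = proj₁ rec ∘ₚ transpose u w , λ y → begin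
    σ (ρ (f y))      ≡⟨ cong σ (proj₂ rec y) ⟩
    σ (σ (g (ρ y)))  ≡⟨ transpose-involutive u w _ ⟩
    g (ρ y)          ≡⟨ transpose-invariant u w g gu≡gw (ρ y) ⟨
    g (σ (ρ y))      ∎
  where
  open ≡-Reasoning
  u = f x
  w = g x
  σ : Fin _ → Fin _
  σ k = transpose u w ⟨$⟩ʳ k
  h : Fin _ → Fin _
  h = σ ∘ g
  fu≡fw : f u ≡ f w
  fu≡fw = proj₁ (proj₂ (grand ne))
  gu≡gw : g u ≡ g w
  gu≡gw = trans (sym (proj₁ (grand ne))) (proj₂ (proj₂ (grand ne)))
  -- If `f y` and `g y` coincided in `u` or `w`, then by the equal kernels `x` and `y` would have
  -- the same image under both functions, and `f x ≡ g x`.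
  still-bad : ∀ {y} → f y ≢ h y → f y ≢ g y
  still-bad {y} fy≢hy e with transpose-cases u w (g y)
  ... | inj₁ (gy≡u , _)            = ne (trans (sym gy≡u) (f⇒g (trans e gy≡u)))
  ... | inj₂ (inj₁ (gy≡w , _))     = ne (trans (sym (g⇒f gy≡w)) (trans e gy≡w))
  ... | inj₂ (inj₂ (_ , _ , fix))  = fy≢hy (trans e (sym fix))
  bad′ : ∀ {y} → f y ≢ h y → y ∈ xs
  bad′ fy≢hy with bad (still-bad fy≢hy)
  ... | here refl = contradiction (sym (transpose-right u w)) fy≢hy
  ... | there p   = p
  -- If the common grandparent of `y` were `u` or `w`, then `x` would share it as a parent with
  -- `f y` or `g y`, where `f` and `g` agree, and again `f x ≡ g x`.
  grand-fixed : ∀ {y} → f y ≢ g y → σ (f (f y)) ≡ f (f y)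
  grand-fixed {y} fy≢gy with grand fy≢gy
  ... | gf , fg , gg = transpose-fixed u w
    (λ e → ne (trans (sym e) (trans gf (f⇒g e))))
    (λ e → ne (trans (sym (g⇒f (trans (sym gg) e))) (trans (sym fg) e)))
  grand′ : ∀ {y} → f y ≢ h y → CommonGrandparent f h y
  grand′ {y} fy≢hy with grand (still-bad fy≢hy) | grand-fixed (still-bad fy≢hy)
  ... | gf , fg , gg | fix =
    trans (sym fix) (cong σ gf) ,
    trans fg (sym (transpose-invariant u w f fu≡fw (g y))) ,
    trans (sym fix) (cong σ (trans gg (sym (transpose-invariant u w g gu≡gw (g y)))))
  rec = conjugate xs f h (cong σ ∘ f⇒g)
    (λ e → g⇒f (trans (sym (transpose-involutive u w _)) (trans (cong σ e) (transpose-involutive u w _))))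
    grand′ bad′
  ρ : Fin _ → Fin _
  ρ k = proj₁ rec ⟨$⟩ʳ k

-- Diametral pairs whose distance shrinks

module Shrinking {V : Set} (M M′ : TreeMetric V) {H : V → V → Set}
                 (sparse : SparseRelation H) (agree : Agree M M′ H) (avoid : Avoiding H) where
  open TreeMetric M
  open TreeMetric M′ using () renaming
    (D to D′; _~_ to _~′_; D-refl to D′-refl; D-tri to D′-tri; flip to flip′; push to push′; dist₃ to dist′₃)
  open SparseRelation sparse
  open Compare M M′ sparse agree
  open FindExchange M M′ sparse agree avoid

  -- A geodesic all of whose edges survive would bound the distance in the second tree. The
  -- inequality records that a geodesic from `x` to `y` passes `p` and then `q`.
  lost-edge : ∀ k {x y} → D x y ≡ k → k < D′ x y →
              ∃₂ λ p q → p ~ q × ¬ (p ~′ q) × D x p + suc (D y q) ≤ k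
  lost-edge zero xy lt with refl ← D-eq xy = contradiction (subst (0 <_) (D′-refl _) lt) λ ()
  lost-edge (suc k) {x} {y} xy lt with D-next xy
  ... | w , xw , wy with D′ x w ≟ⁿ 1
  ...   | no ¬xw′ = x , w , xw , ¬xw′ , ≤-reflexive (cong₂ _+_ (D-refl x) (add 1 (flip wy)))
  ...   | yes xw′ with lost-edge k wy (≤-pred (≤-trans lt (subst (λ d → D′ x y ≤ d + D′ w y) xw′ (D′-tri x w y))))
  ...     | p , q , pq , ¬pq′ , le = p , q , pq , ¬pq′ ,
    ≤-trans (+-monoˡ-≤ (suc (D y q)) (subst (λ d → D x p ≤ d + D w p) xw (D-tri x w p))) (s≤s le)

  -- `y` is `v` or a companion, so its H-neighbours are `u` and `b`, and `x` is one of them. For `b`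
  -- the distance is smaller in the second tree. For `u`, the vertex `z` is at least as far from `y`
  -- in the second tree, hence H-related to `y`, though it is neither `u` nor `b`.
  ends-at-v : ∀ {u v a b x y} → Exchange⁺ M M′ H u v a b → D y u ≡ suc (D y v) → D x y < D′ x y →
              ¬ (∀ p q → D′ x y ≤ D′ p q → H p q)
  ends-at-v {u} {v} {a} {b} {x} {y} E⁺ yu lt far = cases (behind-v exchange yu)
    where
    open Exchange⁺ E⁺
    open Exchange exchange
    Hyx : H y x
    Hyx = H-sym (far x y ≤-refl)
    clash : ∀ {i j} → D x y ≡ i → D′ x y ≡ j → ¬ i < j → ⊥
    clash refl refl ¬lt = ¬lt lt
    cases : y ≡ v ⊎ Companion exchange y → ⊥
    cases (inj₁ refl) with cap Hvu Hvb u≢b Hyx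
    ... | inj₁ refl = outside Hvu Hvb u≢b z≢u z≢b
      (H-sym (far z v (subst₂ _≤_ (sym (dist′₃ (flip′ a~′u) a~′b b~′v u≢b a≢v)) (sym zv) (s≤s (s≤s (s≤s z≤n))))))
    ... | inj₂ refl = clash (dist₃ (flip a~b) a~u u~v (u≢b ∘ sym) a≢v) b~′v λ { (s≤s ()) }
    cases (inj₂ C) with cap (Companion.Hyu C) (Companion.Hyb C) u≢b Hyx
    ... | inj₁ refl = outside (Companion.Hyu C) (Companion.Hyb C) u≢b z≢u z≢b
      (H-sym (far z y (subst₂ _≤_ (sym (flip′ (Companion.yu′ C)))
        (sym (push′ b~′v (Companion.v~′y C) (Companion.y≢b C ∘ sym) zb zv)) (s≤s (s≤s (s≤s (s≤s z≤n)))))))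
    ... | inj₂ refl = clash (flip (Companion.yb C)) (flip′ (Companion.yb′ C)) λ { (s≤s (s≤s ())) }

  ¬shrink : ∀ {x y} → (∀ p q → D′ x y ≤ D′ p q → H p q) → ¬ D x y < D′ x y
  ¬shrink {x} {y} far lt with lost-edge _ refl lt
  ... | p , q , pq , ¬pq′ , le with find-exchange pq ¬pq′
  ...   | inj₁ (a , b , E⁺) = ends-at-v E⁺ yp lt far
    where
    yp : D y p ≡ suc (D y q)
    yp with D-par pq y
    ... | inj₂ e = e
    -- In this orientation the walk from `x` over `p` to `y` would be shorter than the geodesic.
    ... | inj₁ e = ⊥-elim (1+n≰n (≤-trans (≤-trans (+-monoʳ-< (D x p) (s≤s (≤-trans (n≤1+n _) (≤-reflexive (sym e))))) le) (subst (λ d → D x y ≤ D x p + d) (D-sym p y) (D-tri x p y))))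
  ...   | inj₂ (a , b , E⁺) = ends-at-v E⁺ xq (subst₂ _<_ (D-sym x y) (TreeMetric.D-sym M′ x y) lt)
                                (λ s t le′ → far s t (subst (_≤ D′ s t) (TreeMetric.D-sym M′ y x) le′))
    where
    xq : D x q ≡ suc (D x p)
    xq with D-par pq x
    ... | inj₁ e = e
    ... | inj₂ e = ⊥-elim (1+n≰n (≤-trans (≤-trans (+-mono-≤ (≤-reflexive (sym e)) (n≤1+n (D y q))) le) (subst (λ d → D x y ≤ D x q + d) (D-sym q y) (D-tri x q y))))

-- Distances in trees

least : ∀ {P : ℕ → Set} → (∀ k → Dec (P k)) → ∀ k → P k → ∃[ d ] (P d × ∀ j → P j → d ≤ j)
least P? k p with P? 0
... | yes p₀ = 0 , p₀ , λ _ _ → z≤n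
least P? zero    p | no ¬p₀ = contradiction p ¬p₀
least {P} P? (suc k) p | no ¬p₀ with least (P? ∘ suc) k p
... | d , q , min = suc d , q , min′
  where
  min′ : ∀ j → P j → suc d ≤ j
  min′ zero    p₀ = contradiction p₀ ¬p₀
  min′ (suc j) pⱼ = s≤s (min j pⱼ)

module _ {n : ℕ} (G : SimpleGraph n) where

  adj⇒≢ : ∀ {x y} → adj G x y ≡ true → x ≢ y
  adj⇒≢ {x} e refl with () ← trans (sym e) (adj-irr G x)

  adj-flip : ∀ {x y} → adj G x y ≡ true → adj G y x ≡ true
  adj-flip {x} {y} = trans (adj-sym G y x)

  walk? : ∀ k x y → Dec (Walk G x y k)
  walk? zero x y with x ≟ y
  ... | yes refl = yes here
  ... | no x≢y   = no λ { here → x≢y refl }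
  walk? (suc k) x y with any? (λ w → (adj G x w ≟ᵇ true) ×-dec walk? k w y)
  ... | yes (w , e , p) = yes (step e p)
  ... | no ¬p           = no λ { (step e p) → ¬p (_ , e , p) }

  _++ʷ_ : ∀ {x y z j k} → Walk G x y j → Walk G y z k → Walk G x z (j + k)
  here       ++ʷ q = q
  (step e p) ++ʷ q = step e (p ++ʷ q)

  reverseʷ : ∀ {x y k} → Walk G x y k → Walk G y x k
  reverseʷ p = subst (Walk G _ _) (+-identityʳ _) (go p here)
    where
    go : ∀ {x y z j k} → Walk G x y j → Walk G x z k → Walk G y z (j + k)
    go here                   q = q
    go (step {k = j} e p) q = subst (Walk G _ _) (+-suc j _) (go p (step (adj-flip e) q))

  data Avoid (x : Fin n) : Fin n → Fin n → Set where
    stop : ∀ {y} → y ≢ x → Avoid x y y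
    move : ∀ {y w z} → y ≢ x → adj G y w ≡ true → Avoid x w z → Avoid x y z

  _++ᵃ_ : ∀ {x y z t} → Avoid x y z → Avoid x z t → Avoid x y t
  stop _       ++ᵃ q = q
  move y≢x e p ++ᵃ q = move y≢x e (p ++ᵃ q)

  reverseᵃ : ∀ {x y z} → Avoid x y z → Avoid x z y
  reverseᵃ (stop y≢x)     = stop y≢x
  reverseᵃ (move y≢x e p) = reverseᵃ p ++ᵃ move (head p) (adj-flip e) (stop y≢x)
    where
    head : ∀ {x y z} → Avoid x y z → y ≢ x
    head (stop y≢x)     = y≢x
    head (move y≢x _ _) = y≢x

  record SimplePath (x y z : Fin n) (len : ℕ) : Set where
    field
      at        : Fin (suc len) → Fin n
      injective : Injective _≡_ _≡_ at
      start     : at zero ≡ y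
      end       : at (fromℕ len) ≡ z
      edges     : ∀ i → adj G (at (inject₁ i)) (at (suc i)) ≡ true
      avoids    : ∀ i → at i ≢ x

  suffix : ∀ {x y z k} (P : SimplePath x y z k) → ∀ i → ∃ (SimplePath x (SimplePath.at P i) z)
  suffix P zero = _ , record { SimplePath P ; start = refl }
  suffix {k = suc k} P (suc i) = suffix
    (record { at = at ∘ suc ; injective = suc-injectiveᶠ ∘ injective ; start = refl
            ; end = end ; edges = edges ∘ suc ; avoids = avoids ∘ suc }) i
    where open SimplePath P

  -- Induction on the walk: if its first vertex already lies on the path of the rest, the suffix
  -- from there is taken; otherwise it extends that path.
  erase-loops : ∀ {x y z} → Avoid x y z → ∃ (SimplePath x y z)
  erase-loops {y = y} (stop y≢x) = 0 , record
    { at = λ _ → y ; injective = λ { {zero} {zero} _ → refl } ; start = refl ; end = refl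
    ; edges = λ () ; avoids = λ _ → y≢x }
  erase-loops {x} {y} {z} (move y≢x e p) with erase-loops p
  ... | len , P with any? (λ i → SimplePath.at P i ≟ y)
  ...   | yes (i , refl) = suffix P i
  ...   | no ¬y = suc len , record
    { at = at′ ; injective = inj ; start = refl ; end = end ; edges = edges′ ; avoids = avoids′ }
    where
    open SimplePath P
    at′ : Fin (suc (suc len)) → Fin n
    at′ zero    = y
    at′ (suc i) = at i
    inj : Injective _≡_ _≡_ at′
    inj {zero}  {zero}  _ = refl
    inj {zero}  {suc j} q = contradiction (j , sym q) ¬y
    inj {suc i} {zero}  q = contradiction (i , q) ¬y
    inj {suc i} {suc j} q = cong suc (injective q)
    edges′ : ∀ i → adj G (at′ (inject₁ i)) (at′ (suc i)) ≡ true
    edges′ zero    = trans (cong (adj G y) start) e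
    edges′ (suc i) = edges i
    avoids′ : ∀ i → at′ i ≢ x
    avoids′ zero    = y≢x
    avoids′ (suc i) = avoids i

  -- The loop-erased walk is closed at `x`; as `y ≢ z`, it has at least two vertices and the cycle
  -- at least three.
  close-cycle : ∀ {x y z} → adj G x y ≡ true → adj G x z ≡ true → y ≢ z → Avoid x y z → HasCycle G
  close-cycle {x} {y} {z} xy xz y≢z p with erase-loops p
  ... | zero  , P = contradiction (trans (sym (SimplePath.start P)) (SimplePath.end P)) y≢z
  ... | suc m , P = m , c , inj , edges′ , trans (cong (λ t → adj G t x) end) (adj-flip xz)
      where
      open SimplePath P
      c : Fin (suc (suc (suc m))) → Fin n
      c zero    = x
      c (suc i) = at i
      inj : Injective _≡_ _≡_ c
      inj {zero}  {zero}  _ = refl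
      inj {zero}  {suc j} q = contradiction (sym q) (avoids j)
      inj {suc i} {zero}  q = contradiction q (avoids i)
      inj {suc i} {suc j} q = cong suc (injective q)
      edges′ : ∀ i → adj G (c (inject₁ i)) (c (suc i)) ≡ true
      edges′ zero    = trans (cong (adj G x) start) xy
      edges′ (suc i) = edges i

module Distance {n : ℕ} (T : Tree n) where

  private
    G = graph T

  abstract
    shortest : ∀ x y → ∃[ d ] IsDist T x y d
    shortest x y with connected T x y
    ... | k , p = least (λ k → walk? G k x y) k p

  dist : Fin n → Fin n → ℕ
  dist x y = proj₁ (shortest x y)

  isDist : ∀ x y → IsDist T x y (dist x y)
  isDist x y = proj₂ (shortest x y)

  geodesic : ∀ x y → Walk G x y (dist x y)
  geodesic x y = proj₁ (isDist x y)

  dist≤ : ∀ {x y k} → Walk G x y k → dist x y ≤ k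
  dist≤ {x} {y} = proj₂ (isDist x y) _

  IsDist-unique : ∀ {x y d} → IsDist T x y d → dist x y ≡ d
  IsDist-unique {x} {y} (p , min) = ≤-antisym (dist≤ p) (min _ (geodesic x y))

  dist-refl : ∀ x → dist x x ≡ 0
  dist-refl x = n≤0⇒n≡0 (dist≤ here)

  dist-eq : ∀ {x y} → dist x y ≡ 0 → x ≡ y
  dist-eq {x} {y} e with subst (Walk G x y) e (geodesic x y)
  ... | here = refl

  dist-tri : ∀ x y z → dist x z ≤ dist x y + dist y z
  dist-tri x y z = dist≤ (_++ʷ_ G (geodesic x y) (geodesic y z))

  dist-sym : ∀ x y → dist x y ≡ dist y x
  dist-sym x y = ≤-antisym (dist≤ (reverseʷ G (geodesic y x))) (dist≤ (reverseʷ G (geodesic x y)))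

  adj⇒dist : ∀ {x y} → adj G x y ≡ true → dist x y ≡ 1
  adj⇒dist {x} {y} e with dist x y in q | dist≤ (step e here)
  ... | 0           | _      = contradiction (dist-eq q) (adj⇒≢ G e)
  ... | 1           | _      = refl
  ... | suc (suc _) | s≤s ()

  dist⇒adj : ∀ {x y} → dist x y ≡ 1 → adj G x y ≡ true
  dist⇒adj {x} {y} e with subst (Walk G x y) e (geodesic x y)
  ... | step a here = a

  dist-next : ∀ {x y k} → dist x y ≡ suc k → ∃[ w ] (dist x w ≡ 1 × dist w y ≡ k)
  dist-next {x} {y} {k} e with subst (Walk G x y) e (geodesic x y)
  ... | step {y = w} a p = w , adj⇒dist a , ≤-antisym (dist≤ p)
    (≤-pred (subst₂ (λ i j → i ≤ j + dist w y) e (adj⇒dist a) (dist-tri x w y)))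

  -- On a geodesic to `z`, every vertex after the first is strictly closer to `z` than `x` is, hence
  -- different from `x`.
  descend : ∀ {x y z} k → dist z y ≡ k → y ≢ x → k ≤ dist z x → Avoid G x y z
  descend {x} {y} {z} zero zy y≢x le = subst (Avoid G x y) (sym (dist-eq zy)) (stop y≢x)
  descend {x} {y} {z} (suc k) zy y≢x le with dist-next (trans (dist-sym y z) zy)
  ... | w , yw , wz = move y≢x (dist⇒adj yw) (descend k zw w≢x (≤-trans (n≤1+n k) le))
    where
    zw = trans (dist-sym z w) wz
    w≢x : w ≢ x
    w≢x refl = 1+n≰n (subst (suc k ≤_) zw le)

  -- The geodesics from `y` and `y′` to `z` avoid `x`; joined at `z` they close a cycle through `x`.
  fork : ∀ {x y y′ z} → dist x y ≡ 1 → dist x y′ ≡ 1 → y ≢ y′ → dist z y ≤ dist z x → dist z y′ ≤ dist z x → ⊥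
  fork xy xy′ y≢y′ le le′ = acyclic T (close-cycle G (dist⇒adj xy) (dist⇒adj xy′) y≢y′
    (_++ᵃ_ G (descend _ refl (adj⇒≢ G (dist⇒adj xy) ∘ sym) le)
             (reverseᵃ G (descend _ refl (adj⇒≢ G (dist⇒adj xy′) ∘ sym) le′))))

  dist-uniq : ∀ {x y y′ z} → dist x y ≡ 1 → dist x y′ ≡ 1 →
              dist z x ≡ suc (dist z y) → dist z x ≡ suc (dist z y′) → y ≡ y′
  dist-uniq {y = y} {y′} xy xy′ e e′ with y ≟ y′
  ... | yes q = q
  ... | no y≢y′ = ⊥-elim (fork xy xy′ y≢y′ (≤-trans (n≤1+n _) (≤-reflexive (sym e)))
                                           (≤-trans (n≤1+n _) (≤-reflexive (sym e′))))

  -- With `w` the next vertex from `y` towards `z`, equal distances would make `x` and `w` two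
  -- neighbours of `y` no farther from `z` than `y`, against `fork`.
  ¬level : ∀ {x y z} → dist x y ≡ 1 → dist z x ≢ dist z y
  ¬level {x} {y} {z} xy e with zero-or-suc (dist y z)
  ... | inj₁ yz with refl ← dist-eq yz with refl ← dist-eq (trans e (dist-refl z))
                with () ← trans (sym xy) (dist-refl _)
  ... | inj₂ (k , yz) with dist-next yz
  ...   | w , yw , wz = fork (trans (dist-sym y x) xy) yw x≢w (≤-reflexive e)
                          (subst₂ _≤_ (sym zw) (sym zy) (n≤1+n k))
    where
    zy = trans (dist-sym z y) yz
    zw = trans (dist-sym z w) wz
    x≢w : x ≢ w
    x≢w refl = 1+n≢n (trans (sym zy) (trans (sym e) zw))

  dist-par : ∀ {x y} → dist x y ≡ 1 → ∀ z → dist z y ≡ suc (dist z x) ⊎ dist z x ≡ suc (dist z y)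
  dist-par {x} {y} xy z with <-cmp (dist z x) (dist z y)
  ... | tri≈ _ e _ = contradiction e (¬level xy)
  ... | tri< lt _ _ = inj₁ (≤-antisym
    (subst (dist z y ≤_) (trans (cong (dist z x +_) xy) (+-comm _ 1)) (dist-tri z x y)) lt)
  ... | tri> _ _ gt = inj₂ (≤-antisym
    (subst (dist z x ≤_) (trans (cong (dist z y +_) (trans (dist-sym y x) xy)) (+-comm _ 1)) (dist-tri z y x)) gt)

  metric : TreeMetric (Fin n)
  metric = record
    { D = dist ; D-refl = dist-refl ; D-eq = dist-eq ; D-sym = dist-sym ; D-tri = dist-tri
    ; D-next = dist-next ; D-par = dist-par ; D-uniq = dist-uniq }

-- Query graphs with few unqueried pairs

fresh : ∀ {n} (xs : List (Fin n)) → length xs < n → ∃[ z ] z ∉ xs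
fresh xs lt with any? (λ z → ¬? (any∈? (z ≟_) xs))
... | yes found = found
... | no none = contradiction collision λ (i , j , i<j , e) →
    <⇒≢ i<j (trans (lookup-index (covered i)) (trans (cong (lookup xs) e) (sym (lookup-index (covered j)))))
  where
  covered : ∀ z → z ∈ xs
  covered z with any∈? (z ≟_) xs
  ... | yes p = p
  ... | no ¬p = contradiction (z , ¬p) none
  collision = pigeonhole lt (λ z → index (covered z))

Unqueried : ∀ {n} → QueryGraph n → Fin n → Fin n → Set
Unqueried Q x y = x ≢ y × adj Q x y ≡ false

-- `p` and `q` may coincide and need not be unqueried with `x`, so this also covers fewer than two
-- unqueried pairs.
Unqueried≤2 : ∀ {n} → QueryGraph n → Fin n → Set
Unqueried≤2 Q x = ∃₂ λ p q → ∀ y → Unqueried Q x y → y ≡ p ⊎ y ≡ q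

Unqueried-sym : ∀ {n} (Q : QueryGraph n) {x y} → Unqueried Q x y → Unqueried Q y x
Unqueried-sym Q (x≢y , e) = x≢y ∘ sym , trans (adj-sym Q _ _) e

module _ {n : ℕ} (Q : QueryGraph n) (bounded : ∀ x → Unqueried≤2 Q x) where

  unqueried-sparse : SparseRelation (Unqueried Q)
  unqueried-sparse = record { H-sym = Unqueried-sym Q ; cap = cap }
    where
    cap : ∀ {x p q r} → Unqueried Q x p → Unqueried Q x q → p ≢ q → Unqueried Q x r → r ≡ p ⊎ r ≡ q
    cap {x} hp hq p≢q hr with bounded x
    ... | s , t , cover with cover _ hp | cover _ hq | cover _ hr
    ...   | inj₁ p≡s | inj₁ q≡s | _        = contradiction (trans p≡s (sym q≡s)) p≢q
    ...   | inj₂ p≡t | inj₂ q≡t | _        = contradiction (trans p≡t (sym q≡t)) p≢q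
    ...   | inj₁ p≡s | inj₂ q≡t | inj₁ r≡s = inj₁ (trans r≡s (sym p≡s))
    ...   | inj₁ p≡s | inj₂ q≡t | inj₂ r≡t = inj₂ (trans r≡t (sym q≡t))
    ...   | inj₂ p≡t | inj₁ q≡s | inj₁ r≡s = inj₂ (trans r≡s (sym q≡s))
    ...   | inj₂ p≡t | inj₁ q≡s | inj₂ r≡t = inj₁ (trans r≡t (sym p≡t))

  -- Each of the four vertices excludes itself and two possible unqueried partners, at most twelve
  -- vertices in all. This is where the bound 13 comes from.
  unqueried-avoiding : 13 ≤ n → Avoiding (Unqueried Q)
  unqueried-avoiding 13≤n a b c d with fresh (ball a (ball b (ball c (ball d [])))) 13≤n
    where
    ball : Fin n → List (Fin n) → List (Fin n)
    ball x xs = x ∷ proj₁ (bounded x) ∷ proj₁ (proj₂ (bounded x)) ∷ xs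
  ... | z , z∉ = z
      , far a (λ p → z∉ (++⁺ˡ p))
      , far b (λ p → z∉ (there (there (there (++⁺ˡ p)))))
      , far c (λ p → z∉ (there (there (there (there (there (there (++⁺ˡ p))))))))
      , far d (λ p → z∉ (there (there (there (there (there (there (there (there (there (++⁺ˡ p)))))))))))
    where
    far : ∀ x → z ∉ x ∷ proj₁ (bounded x) ∷ proj₁ (proj₂ (bounded x)) ∷ [] → Far (Unqueried Q) z x
    far x z∉x = (λ e → z∉x (here e)) , λ h →
      [ (λ e → z∉x (there (here e))) , (λ e → z∉x (there (there (here e)))) ]′
        (proj₂ (proj₂ (bounded x)) z (Unqueried-sym Q h))

consistent⇒agree : ∀ {n} (Q : QueryGraph n) {T T₁ T₂ : Tree n} → Consistent Q T T₁ → Consistent Q T T₂ →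
                   Agree (Distance.metric T₁) (Distance.metric T₂) (Unqueried Q)
consistent⇒agree Q {T} {T₁} {T₂} c₁ c₂ x y with x ≟ y
... | yes refl = inj₁ (trans (Distance.dist-refl T₁ x) (sym (Distance.dist-refl T₂ x)))
... | no x≢y with adj Q x y ≟ᵇ true
...   | no ¬e = inj₂ (x≢y , ¬-not ¬e)
...   | yes e = inj₁ (trans (Distance.IsDist-unique T₁ (c₁ x y e _ (Distance.isDist T x y)))
                       (sym (Distance.IsDist-unique T₂ (c₂ x y e _ (Distance.isDist T x y)))))

-- Isomorphisms from parent functions

true⇔⇒≡ : ∀ {p q} → (p ≡ true → q ≡ true) → (q ≡ true → p ≡ true) → p ≡ q
true⇔⇒≡ {true}  {q}     to from = sym (to refl)
true⇔⇒≡ {false} {true}  to from = from refl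
true⇔⇒≡ {false} {false} to from = refl

-- `x ≢ y` excludes the loop at the root, which is its own parent.
Linked : ∀ {n} → (Fin n → Fin n) → Fin n → Fin n → Set
Linked f x y = x ≢ y × (f x ≡ y ⊎ f y ≡ x)

module _ {n : ℕ} (T : Tree n) (r : Fin n) where
  open Distance T
  open Rooted metric r
  open TreeMetric metric using (flip; D-par; D-eq)

  adj⇒linked : ∀ {x y} → adj (graph T) x y ≡ true → Linked parent x y
  adj⇒linked {x} {y} e with D-par (adj⇒dist e) r
  ... | inj₁ up   = adj⇒≢ (graph T) e , inj₂ (parent-unique (flip (adj⇒dist e)) up)
  ... | inj₂ down = adj⇒≢ (graph T) e , inj₁ (parent-unique (adj⇒dist e) down)

  parent-adj : ∀ {x y} → x ≢ y → parent x ≡ y → adj (graph T) x y ≡ true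
  parent-adj {x} x≢y refl with zero-or-suc (dist r x)
  ... | inj₁ rx with refl ← D-eq rx = contradiction (sym parent-root) x≢y
  ... | inj₂ (_ , rx) = dist⇒adj (proj₁ (parent-step rx))

  linked⇒adj : ∀ {x y} → Linked parent x y → adj (graph T) x y ≡ true
  linked⇒adj (x≢y , inj₁ e) = parent-adj x≢y e
  linked⇒adj (x≢y , inj₂ e) = adj-flip (graph T) (parent-adj (x≢y ∘ sym) e)

module _ {n : ℕ} (T₁ T₂ : Tree n) {H : Fin n → Fin n → Set} (sparse : SparseRelation H)
         (agree : Agree (Distance.metric T₁) (Distance.metric T₂) H) (avoid : Avoiding H) where

  private
    M₁ = Distance.metric T₁
    M₂ = Distance.metric T₂
    agree′ : Agree M₂ M₁ H
    agree′ = Agree-sym {M = M₁} {M₂} agree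

  -- `moved-siblings` in both directions gives the equal kernels that `conjugate` asks for. A
  -- permutation carrying one parent function to the other preserves linked pairs, that is, edges.
  common-root⇒isomorphic : ∀ r → (∀ x → TreeMetric.D M₁ r x ≡ TreeMetric.D M₂ r x) → Isomorphic T₁ T₂
  common-root⇒isomorphic r hub = π , λ x y → true⇔⇒≡
      (λ e → linked⇒adj T₁ r (back (adj⇒linked T₂ r e)))
      (λ e → linked⇒adj T₂ r (forth (adj⇒linked T₁ r e)))
    where
    module S₁ = SharedRoot M₁ M₂ sparse agree avoid r hub
    module S₂ = SharedRoot M₂ M₁ sparse agree′ avoid r (sym ∘ hub)
    f = Rooted.parent M₁ r
    g = Rooted.parent M₂ r
    f⇒g : ∀ {x y} → f x ≡ f y → g x ≡ g y
    f⇒g {x} {y} e with x ≟ y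
    ... | yes refl = refl
    ... | no x≢y with f x ≟ g x | f y ≟ g y
    ...   | yes p | yes q = trans (sym p) (trans e q)
    ...   | no p  | _     = S₁.moved-siblings (S₁.moved p) x≢y e
    ...   | yes _ | no q  = sym (S₁.moved-siblings (S₁.moved q) (x≢y ∘ sym) (sym e))
    g⇒f : ∀ {x y} → g x ≡ g y → f x ≡ f y
    g⇒f {x} {y} e with x ≟ y
    ... | yes refl = refl
    ... | no x≢y with g x ≟ f x | g y ≟ f y
    ...   | yes p | yes q = trans (sym p) (trans e q)
    ...   | no p  | _     = S₂.moved-siblings (S₂.moved p) x≢y e
    ...   | yes _ | no q  = sym (S₂.moved-siblings (S₂.moved q) (x≢y ∘ sym) (sym e))
    conj = conjugate (allFin n) f g f⇒g g⇒f (S₁.Moved.grand ∘ S₁.moved) (λ _ → ∈-allFin _)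
    π = proj₁ conj
    π-injective : ∀ {x y} → π ⟨$⟩ʳ x ≡ π ⟨$⟩ʳ y → x ≡ y
    π-injective {x} {y} e = trans (sym (inverseˡ π)) (trans (cong (π ⟨$⟩ˡ_) e) (inverseˡ π))
    forth : ∀ {x y} → Linked f x y → Linked g (π ⟨$⟩ʳ x) (π ⟨$⟩ʳ y)
    forth {x} {y} (x≢y , inj₁ e) = x≢y ∘ π-injective , inj₁ (trans (sym (proj₂ conj x)) (cong (π ⟨$⟩ʳ_) e))
    forth {x} {y} (x≢y , inj₂ e) = x≢y ∘ π-injective , inj₂ (trans (sym (proj₂ conj y)) (cong (π ⟨$⟩ʳ_) e))
    back : ∀ {x y} → Linked g (π ⟨$⟩ʳ x) (π ⟨$⟩ʳ y) → Linked f x y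
    back {x} {y} (ne , inj₁ e) = ne ∘ cong (π ⟨$⟩ʳ_) , inj₁ (π-injective (trans (proj₂ conj x) e))
    back {x} {y} (ne , inj₂ e) = ne ∘ cong (π ⟨$⟩ʳ_) , inj₂ (π-injective (trans (proj₂ conj y) e))

lost-edge⇒common-root : ∀ {V : Set} (M M′ : TreeMetric V) {H} → SparseRelation H → Agree M M′ H → Avoiding H →
  ∀ {x y} → TreeMetric.D M x y ≡ 1 → TreeMetric.D M′ x y ≢ 1 →
  ∃[ r ] (∀ t → TreeMetric.D M r t ≡ TreeMetric.D M′ r t)
lost-edge⇒common-root M M′ {H} sparse agree avoid xy ¬xy′ =
  [ root , root ]′ (FindExchange.find-exchange M M′ sparse agree avoid xy ¬xy′)
  where
  root : ∀ {u v} → ∃₂ (λ a b → Exchange⁺ M M′ H u v a b) → _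
  root (a , b , E) = a , λ t → trans (TreeMetric.D-sym M a t)
    (trans (exchange⇒hub M M′ sparse agree (Exchange⁺.exchange E) t) (TreeMetric.D-sym M′ t a))

agree⇒isomorphic : ∀ {n} (T₁ T₂ : Tree n) {H : Fin n → Fin n → Set} → SparseRelation H →
                   Agree (Distance.metric T₁) (Distance.metric T₂) H → Avoiding H → Isomorphic T₁ T₂
agree⇒isomorphic T₁ T₂ {H} sparse agree avoid
  with any? (λ x → any? (λ y → ¬? (adj (graph T₂) x y ≟ᵇ adj (graph T₁) x y)))
... | no same = idₚ , λ x y → decidable-stable (_ ≟ᵇ _) (λ ne → same (x , y , ne))
... | yes (x , y , ne) = root (adj (graph T₁) x y) refl
  where
  M₁ = Distance.metric T₁
  M₂ = Distance.metric T₂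
  iso = common-root⇒isomorphic T₁ T₂ sparse agree avoid
  root : ∀ b → adj (graph T₁) x y ≡ b → Isomorphic T₁ T₂
  root true e with lost-edge⇒common-root M₁ M₂ sparse agree avoid (Distance.adj⇒dist T₁ e)
                     (λ q → ne (trans (Distance.dist⇒adj T₂ q) (sym e)))
  ... | r , hub = iso r hub
  root false e with lost-edge⇒common-root M₂ M₁ sparse (Agree-sym {M = M₁} {M₂} agree) avoid
                      (Distance.adj⇒dist T₂ (trans (¬-not ne) (cong not e)))
                      (λ q → case trans (sym e) (Distance.dist⇒adj T₁ q) of λ ())
  ... | r , hub = iso r (sym ∘ hub)

-- Diameters of consistent trees

argmax : ∀ {n} → 0 < n → (F : Fin n → ℕ) → ∃[ i ] (∀ j → F j ≤ F i)
argmax {suc zero}    _ F = zero , λ { zero → ≤-refl }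
argmax {suc (suc n)} _ F with argmax (s≤s z≤n) (F ∘ suc)
... | i , max with F zero ≤? F (suc i)
...   | yes le = suc i , λ { zero → le ; (suc j) → max j }
...   | no ¬le = zero , λ { zero → ≤-refl ; (suc j) → ≤-trans (max j) (<⇒≤ (≰⇒> ¬le)) }

diameter : ∀ {n} → 0 < n → (T : Tree n) →
           ∃₂ λ x y → ∀ u v → Distance.dist T u v ≤ Distance.dist T x y
diameter 0<n T with argmax 0<n (λ u → Distance.dist T u (proj₁ (argmax 0<n (Distance.dist T u))))
... | x , max = x , _ , λ u v → ≤-trans (proj₂ (argmax 0<n (Distance.dist T u)) v) (max u)

module _ {n : ℕ} {T T′ : Tree n} (iso : Isomorphic T T′) where

  private
    σ = proj₁ iso

  isomorphic-walk : ∀ {x y k} → Walk (graph T) x y k → Walk (graph T′) (σ ⟨$⟩ʳ x) (σ ⟨$⟩ʳ y) k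
  isomorphic-walk here       = here
  isomorphic-walk (step e p) = step (trans (proj₂ iso _ _) e) (isomorphic-walk p)

  isomorphic-dist≤ : ∀ {d} → (∀ x y → Distance.dist T x y ≤ d) → ∀ u v → Distance.dist T′ u v ≤ d
  isomorphic-dist≤ bound u v = ≤-trans (Distance.dist≤ T′
    (subst₂ (λ s t → Walk (graph T′) s t (Distance.dist T (σ ⟨$⟩ˡ u) (σ ⟨$⟩ˡ v))) (inverseʳ σ) (inverseʳ σ)
      (isomorphic-walk (Distance.geodesic T (σ ⟨$⟩ˡ u) (σ ⟨$⟩ˡ v))))) (bound _ _)

isDiamPair : ∀ {n} (T : Tree n) {x y} → (∀ u v → Distance.dist T u v ≤ Distance.dist T x y) → IsDiamPair T x y
isDiamPair T bound u v a b da db =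
  subst₂ _≤_ (Distance.IsDist-unique T db) (Distance.IsDist-unique T da) (bound u v)

module _ {n : ℕ} (13≤n : 13 ≤ n) (Q : QueryGraph n) (bounded : ∀ x → Unqueried≤2 Q x) where

  private
    sparse = unqueried-sparse Q bounded
    avoid  = unqueried-avoiding Q bounded 13≤n

  determinesIso : DeterminesIso Q
  determinesIso T T₁ T₂ c₁ c₂ = agree⇒isomorphic T₁ T₂ sparse (consistent⇒agree Q {T} {T₁} {T₂} c₁ c₂) avoid

  -- Consistent trees are isomorphic, so none has a larger diameter than `T`. A queried diametral
  -- pair keeps its distance. If there is none, every pair as far apart as `x₀` and `y₀` is
  -- unqueried, and `¬shrink` protects the distance of these two.
  findsMaxPair : FindsMaxPair Q
  findsMaxPair T with diameter (≤-trans (s≤s z≤n) 13≤n) T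
  ... | x₀ , y₀ , max = choose
      (any? (λ x → any? (λ y → (adj Q x y ≟ᵇ true) ×-dec (dist x y ≟ⁿ dist x₀ y₀))))
    where
    open Distance T
    self : Consistent Q T T
    self _ _ _ _ d = d
    bound : ∀ T′ → Consistent Q T T′ → ∀ u v → Distance.dist T′ u v ≤ dist x₀ y₀
    bound T′ c = isomorphic-dist≤ {T = T} {T′} (determinesIso T T T′ self c) max
    choose : Dec (∃₂ λ x y → adj Q x y ≡ true × dist x y ≡ dist x₀ y₀) →
             ∃₂ λ x y → ∀ T′ → Consistent Q T T′ → IsDiamPair T′ x y
    choose (yes (x , y , q , e)) = x , y , λ T′ c → isDiamPair T′ λ u v →
      subst (Distance.dist T′ u v ≤_)
        (trans (sym e) (sym (Distance.IsDist-unique T′ (c x y q _ (isDist x y))))) (bound T′ c u v)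
    choose (no none) = x₀ , y₀ , λ T′ c → isDiamPair T′ λ u v → ≤-trans (bound T′ c u v) (kept T′ c)
      where
      kept : ∀ T′ → Consistent Q T T′ → dist x₀ y₀ ≤ Distance.dist T′ x₀ y₀
      kept T′ c with dist x₀ y₀ ≤? Distance.dist T′ x₀ y₀
      ... | yes le = le
      ... | no ¬le = ⊥-elim (Shrinking.¬shrink (Distance.metric T′) metric sparse
                       (consistent⇒agree Q {T} {T′} {T} c self) avoid far (≰⇒> ¬le))
        where
        far : ∀ p q → dist x₀ y₀ ≤ dist p q → Unqueried Q p q
        far p q le = p≢q , ¬-not (λ e → none (p , q , e , ≤-antisym (max p q) le))
          where
          p≢q : p ≢ q
          p≢q refl = ¬le (≤-trans le (≤-trans (≤-reflexive (dist-refl p)) z≤n))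

-- Two consistent trees of different diameter

cycle-neighbours : ∀ {n} (G : SimpleGraph n) {k} (c : Fin (suc (suc (suc k))) → Fin n) →
  (∀ i → adj G (c (inject₁ i)) (c (suc i)) ≡ true) → adj G (c (fromℕ (suc (suc k)))) (c zero) ≡ true →
  ∀ i → ∃₂ λ p q → p ≢ q × adj G (c i) (c p) ≡ true × adj G (c i) (c q) ≡ true
cycle-neighbours G c edges close zero =
  suc zero , fromℕ _ , (λ ()) , edges zero , adj-flip G close
cycle-neighbours G c edges close (suc i) with view i
... | ‵fromℕ     = inject₁ (fromℕ _) , zero , (λ ()) , adj-flip G (edges (fromℕ _)) , close
... | ‵inject₁ j = inject₁ (inject₁ j) , suc (suc j) , distinct , adj-flip G (edges (inject₁ j)) , edges (suc j)
  where
  distinct : inject₁ (inject₁ j) ≢ suc (suc j)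
  distinct e = grows 1 (trans (sym (trans (toℕ-inject₁ _) (toℕ-inject₁ j))) (cong toℕ e))

-- A deepest vertex of a cycle would have two distinct parents.
parent⇒acyclic : ∀ {n} (G : SimpleGraph n) (parent : Fin n → Fin n) (depth : Fin n → ℕ) →
  (∀ {x y} → adj G x y ≡ true →
     (y ≡ parent x × depth y < depth x) ⊎ (x ≡ parent y × depth x < depth y)) →
  ¬ HasCycle G
parent⇒acyclic G parent depth edge (k , c , inj , edges , close)
  with argmax (s≤s z≤n) (depth ∘ c)
... | i , max with cycle-neighbours G c edges close i
...   | p , q , p≢q , ip , iq = p≢q (inj (trans (up ip) (sym (up iq))))
  where
  up : ∀ {j} → adj G (c i) (c j) ≡ true → c j ≡ parent (c i)
  up {j} e with edge e
  ... | inj₁ (par , _) = par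
  ... | inj₂ (_ , lt)  = contradiction (max j) (<⇒≱ lt)

-- The roles of the vertices in the two trees, with `ko` for all that remain. Adjacency will depend
-- on kinds only, so claims for every `n` reduce to finite checks.
data Kind : Set where
  kv ka kb kc km ko : Kind

allᵏ : (Kind → Bool) → Bool
allᵏ P = P kv ∧ P ka ∧ P kb ∧ P kc ∧ P km ∧ P ko

allᵏ-sound : ∀ P → allᵏ P ≡ true → ∀ k → P k ≡ true
allᵏ-sound P e k with P kv in v | P ka in a | P kb in b | P kc in c | P km in m | P ko in o
allᵏ-sound P e kv | true | true | true | true | true | true = v
allᵏ-sound P e ka | true | true | true | true | true | true = a
allᵏ-sound P e kb | true | true | true | true | true | true = b
allᵏ-sound P e kc | true | true | true | true | true | true = c
allᵏ-sound P e km | true | true | true | true | true | true = m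
allᵏ-sound P e ko | true | true | true | true | true | true = o

-- Lets `refl` verify an implication between relations on kinds by evaluating all 36 pairs.
allᵏ²-sound : ∀ (P R : Kind → Kind → Bool) → allᵏ (λ k → allᵏ λ l → not (P k l) ∨ R k l) ≡ true →
              ∀ k l → P k l ≡ true → R k l ≡ true
allᵏ²-sound P R e k l p = trans (cong (λ b → not b ∨ R k l) (sym p))
  (allᵏ-sound (λ l → not (P k l) ∨ R k l) (allᵏ-sound (λ k → allᵏ λ l → not (P k l) ∨ R k l) e k) l)

-- The edges of the two ambiguous trees, directed to the root: c hangs at a, all other
-- vertices hang at the root m, except v, which hangs at a or at b.
child : Bool → Kind → Kind → Bool
child s kv ka = s
child s kv kb = not s
child s ka km = true
child s kb km = true
child s kc ka = true
child s ko km = true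
child s _  _  = false

up : Bool → Kind → Kind
up true  kv = ka
up false kv = kb
up s     kc = ka
up s     _  = km

depth : Kind → ℕ
depth kv = 2
depth kc = 2
depth km = 0
depth _  = 1

child-up : ∀ s k l → child s k l ≡ true → l ≡ up s k × depth l < depth k
child-up true  kv ka _ = refl , s≤s (s≤s z≤n)
child-up false kv kb _ = refl , s≤s (s≤s z≤n)
child-up true  ka km _ = refl , s≤s z≤n
child-up false ka km _ = refl , s≤s z≤n
child-up true  kb km _ = refl , s≤s z≤n
child-up false kb km _ = refl , s≤s z≤n
child-up true  kc ka _ = refl , s≤s (s≤s z≤n)
child-up false kc ka _ = refl , s≤s (s≤s z≤n)
child-up true  ko km _ = refl , s≤s z≤n
child-up false ko km _ = refl , s≤s z≤n

link : Bool → Kind → Kind → Bool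
link s k l = child s k l ∨ child s l k

link-irr : ∀ s k → link s k k ≡ false
link-irr s kv = refl
link-irr s ka = refl
link-irr s kb = refl
link-irr s kc = refl
link-irr s km = refl
link-irr s ko = refl

link-up : ∀ s k l → link s k l ≡ true → (l ≡ up s k × depth l < depth k) ⊎ (k ≡ up s l × depth k < depth l)
link-up s k l e with child s k l in p
... | true  = inj₁ (child-up s k l p)
... | false = inj₂ (child-up s l k e)

depth≤2 : ∀ k → depth k ≤ 2
depth≤2 k = ≤ᵇ⇒≤ _ _ (subst T (sym (allᵏ-sound (λ k → depth k ≤ᵇ 2) refl k)) _)

-- Kind maps inducing graph homomorphisms between the two trees, between them fixing every
-- pair of kinds other than v with a, b or c.
drop-v v-at-b v-at-a : Kind → Kind
drop-v kv = km
drop-v k  = k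
v-at-b ka = kb
v-at-b kc = km
v-at-b k  = k
v-at-a kb = ka
v-at-a k  = k

drop-v-fixes : ∀ k → k ≡ kv ⊎ drop-v k ≡ k
drop-v-fixes kv = inj₁ refl
drop-v-fixes ka = inj₂ refl
drop-v-fixes kb = inj₂ refl
drop-v-fixes kc = inj₂ refl
drop-v-fixes km = inj₂ refl
drop-v-fixes ko = inj₂ refl

v-at-fixes : ∀ k → (k ≡ ka ⊎ k ≡ kb ⊎ k ≡ kc) ⊎ (v-at-b k ≡ k × v-at-a k ≡ k)
v-at-fixes kv = inj₂ (refl , refl)
v-at-fixes ka = inj₁ (inj₁ refl)
v-at-fixes kb = inj₁ (inj₂ (inj₁ refl))
v-at-fixes kc = inj₁ (inj₂ (inj₂ refl))
v-at-fixes km = inj₂ (refl , refl)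
v-at-fixes ko = inj₂ (refl , refl)

deep : ∀ k → depth k ≤ 1 ⊎ (k ≡ kv ⊎ k ≡ kc)
deep kv = inj₂ (inj₁ refl)
deep kc = inj₂ (inj₂ refl)
deep ka = inj₁ ≤-refl
deep kb = inj₁ ≤-refl
deep km = inj₁ z≤n
deep ko = inj₁ ≤-refl

module Ambiguous {n : ℕ} {v a b c m : Fin n}
                 (v≢a : v ≢ a) (v≢b : v ≢ b) (v≢c : v ≢ c) (v≢m : v ≢ m) (a≢b : a ≢ b)
                 (a≢c : a ≢ c) (a≢m : a ≢ m) (b≢c : b ≢ c) (b≢m : b ≢ m) (c≢m : c ≢ m) where

  kind : Fin n → Kind
  kind x with x ≟ v | x ≟ a | x ≟ b | x ≟ c | x ≟ m
  ... | yes _ | _     | _     | _     | _     = kv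
  ... | no _  | yes _ | _     | _     | _     = ka
  ... | no _  | no _  | yes _ | _     | _     = kb
  ... | no _  | no _  | no _  | yes _ | _     = kc
  ... | no _  | no _  | no _  | no _  | yes _ = km
  ... | no _  | no _  | no _  | no _  | no _  = ko

  -- The vertex of the given kind; x serves for the kind of all remaining vertices.
  place : Fin n → Kind → Fin n
  place x kv = v
  place x ka = a
  place x kb = b
  place x kc = c
  place x km = m
  place x ko = x

  place-kind : ∀ x → place x (kind x) ≡ x
  place-kind x with x ≟ v | x ≟ a | x ≟ b | x ≟ c | x ≟ m
  ... | yes e | _     | _     | _     | _     = sym e
  ... | no _  | yes e | _     | _     | _     = sym e
  ... | no _  | no _  | yes e | _     | _     = sym e
  ... | no _  | no _  | no _  | yes e | _     = sym e
  ... | no _  | no _  | no _  | no _  | yes e = sym e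
  ... | no _  | no _  | no _  | no _  | no _  = refl

  of-kind : ∀ {x k} → kind x ≡ k → x ≡ place x k
  of-kind {x} e = trans (sym (place-kind x)) (cong (place x) e)

  kind-place : ∀ x k → (k ≡ ko → kind x ≡ ko) → kind (place x k) ≡ k
  kind-place x ko h = h refl
  kind-place x kv _ with v ≟ v
  ... | yes _ = refl
  ... | no ¬e = contradiction refl ¬e
  kind-place x ka _ with a ≟ v | a ≟ a
  ... | yes e | _     = contradiction (sym e) v≢a
  ... | no _  | yes _ = refl
  ... | no _  | no ¬e = contradiction refl ¬e
  kind-place x kb _ with b ≟ v | b ≟ a | b ≟ b
  ... | yes e | _     | _     = contradiction (sym e) v≢b
  ... | no _  | yes e | _     = contradiction (sym e) a≢b
  ... | no _  | no _  | yes _ = refl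
  ... | no _  | no _  | no ¬e = contradiction refl ¬e
  kind-place x kc _ with c ≟ v | c ≟ a | c ≟ b | c ≟ c
  ... | yes e | _     | _     | _     = contradiction (sym e) v≢c
  ... | no _  | yes e | _     | _     = contradiction (sym e) a≢c
  ... | no _  | no _  | yes e | _     = contradiction (sym e) b≢c
  ... | no _  | no _  | no _  | yes _ = refl
  ... | no _  | no _  | no _  | no ¬e = contradiction refl ¬e
  kind-place x km _ with m ≟ v | m ≟ a | m ≟ b | m ≟ c | m ≟ m
  ... | yes e | _     | _     | _     | _     = contradiction (sym e) v≢m
  ... | no _  | yes e | _     | _     | _     = contradiction (sym e) a≢m
  ... | no _  | no _  | yes e | _     | _     = contradiction (sym e) b≢m
  ... | no _  | no _  | no _  | yes e | _     = contradiction (sym e) c≢m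
  ... | no _  | no _  | no _  | no _  | yes _ = refl
  ... | no _  | no _  | no _  | no _  | no ¬e = contradiction refl ¬e

  kind-v : kind v ≡ kv
  kind-v = kind-place m kv λ ()
  kind-a : kind a ≡ ka
  kind-a = kind-place m ka λ ()
  kind-b : kind b ≡ kb
  kind-b = kind-place m kb λ ()
  kind-c : kind c ≡ kc
  kind-c = kind-place m kc λ ()
  kind-m : kind m ≡ km
  kind-m = kind-place m km λ ()

  G : Bool → SimpleGraph n
  G s = record
    { adj     = λ x y → link s (kind x) (kind y)
    ; adj-sym = λ x y → ∨-comm (child s (kind x) (kind y)) _
    ; adj-irr = λ x → link-irr s (kind x) }

  edge : ∀ s {x y k l} → kind x ≡ k → kind y ≡ l → link s k l ≡ true → adj (G s) x y ≡ true
  edge s refl refl e = e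

  climb : ∀ s x k → kind x ≡ k → Walk (G s) x m (depth k)
  climb true  x kv e = step (edge true e kind-a refl) (step (edge true kind-a kind-m refl) here)
  climb false x kv e = step (edge false e kind-b refl) (step (edge false kind-b kind-m refl) here)
  climb s     x ka e = step (edge s e kind-m refl) here
  climb s     x kb e = step (edge s e kind-m refl) here
  climb s     x kc e = step (edge s e kind-a refl) (step (edge s kind-a kind-m refl) here)
  climb s     x km e = subst (λ t → Walk (G s) t m 0) (sym (of-kind e)) here
  climb s     x ko e = step (edge s e kind-m refl) here

  via-m : ∀ s x y → Walk (G s) x y (depth (kind x) + depth (kind y))
  via-m s x y = _++ʷ_ (G s) (climb s x _ refl) (reverseʷ (G s) (climb s y _ refl))

  -- A parent is never of kind `ko`, the only kind whose place depends on the vertex.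
  place-up : ∀ s k x y → place x (up s k) ≡ place y (up s k)
  place-up true  kv x y = refl
  place-up false kv x y = refl
  place-up true  ka x y = refl
  place-up false ka x y = refl
  place-up true  kb x y = refl
  place-up false kb x y = refl
  place-up true  kc x y = refl
  place-up false kc x y = refl
  place-up true  km x y = refl
  place-up false km x y = refl
  place-up true  ko x y = refl
  place-up false ko x y = refl

  tree : Bool → Tree n
  tree s = record
    { graph = G s
    ; connected = λ x y → _ , via-m s x y
    ; acyclic = parent⇒acyclic (G s) (λ x → place x (up s (kind x))) (depth ∘ kind) up-edge }
    where
    up-edge : ∀ {x y} → adj (G s) x y ≡ true →
      (y ≡ place x (up s (kind x)) × depth (kind y) < depth (kind x)) ⊎
      (x ≡ place y (up s (kind y)) × depth (kind x) < depth (kind y))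
    up-edge {x} {y} e with link-up s (kind x) (kind y) e
    ... | inj₁ (p , lt) = inj₁ (trans (of-kind p) (place-up s (kind x) y x) , lt)
    ... | inj₂ (p , lt) = inj₂ (trans (of-kind p) (place-up s (kind y) x y) , lt)

  -- A homomorphism carries walks to walks of the same length, so homomorphisms in both directions
  -- that fix the ends give equal distances. Only `ko` may be sent to `ko`, because `place x ko` is
  -- `x` itself.
  walk-along : ∀ s t (φ : Kind → Kind) → (∀ k → φ k ≡ ko → k ≡ ko) →
               (∀ k l → link s k l ≡ true → link t (φ k) (φ l) ≡ true) →
               ∀ {x y j} → φ (kind x) ≡ kind x → φ (kind y) ≡ kind y → Walk (G s) x y j → Walk (G t) x y j
  walk-along s t φ φ-ko hom {x} {y} {j} fx fy p =
    subst₂ (λ x y → Walk (G t) x y j) (fixed fx) (fixed fy) (along p)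
    where
    φ̂ : Fin n → Fin n
    φ̂ x = place x (φ (kind x))
    kind-φ̂ : ∀ x → kind (φ̂ x) ≡ φ (kind x)
    kind-φ̂ x = kind-place x _ (φ-ko (kind x))
    fixed : ∀ {x} → φ (kind x) ≡ kind x → φ̂ x ≡ x
    fixed {x} e = trans (cong (place x) e) (place-kind x)
    along : ∀ {x y j} → Walk (G s) x y j → Walk (G t) (φ̂ x) (φ̂ y) j
    along here       = here
    along (step {x} {y} e p) = step (edge t (kind-φ̂ x) (kind-φ̂ y) (hom _ _ e)) (along p)

  drop-v-walk : ∀ s t {x y j} → drop-v (kind x) ≡ kind x → drop-v (kind y) ≡ kind y →
                Walk (G s) x y j → Walk (G t) x y j
  drop-v-walk s t = walk-along s t drop-v (λ { ko _ → refl }) (hom s t)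
    where
    hom : ∀ s t k l → link s k l ≡ true → link t (drop-v k) (drop-v l) ≡ true
    hom true  true  = allᵏ²-sound (link true) (λ k l → link true (drop-v k) (drop-v l)) refl
    hom true  false = allᵏ²-sound (link true) (λ k l → link false (drop-v k) (drop-v l)) refl
    hom false true  = allᵏ²-sound (link false) (λ k l → link true (drop-v k) (drop-v l)) refl
    hom false false = allᵏ²-sound (link false) (λ k l → link false (drop-v k) (drop-v l)) refl

  v-at-b-walk : ∀ {x y j} → v-at-b (kind x) ≡ kind x → v-at-b (kind y) ≡ kind y →
                Walk (G true) x y j → Walk (G false) x y j
  v-at-b-walk = walk-along true false v-at-b (λ { ko _ → refl })
    (allᵏ²-sound (link true) (λ k l → link false (v-at-b k) (v-at-b l)) refl)

  v-at-a-walk : ∀ {x y j} → v-at-a (kind x) ≡ kind x → v-at-a (kind y) ≡ kind y →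
                Walk (G false) x y j → Walk (G true) x y j
  v-at-a-walk = walk-along false true v-at-a (λ { ko _ → refl })
    (allᵏ²-sound (link false) (λ k l → link true (v-at-a k) (v-at-a l)) refl)

  -- A function of the kind that rises by at most one along each edge bounds distances from below.
  lipschitz : ∀ s (h : Kind → ℕ) → (∀ k l → link s k l ≡ true → (h l ≤ᵇ suc (h k)) ≡ true) →
              ∀ {x y j} → Walk (G s) x y j → h (kind y) ≤ j + h (kind x)
  lipschitz s h bound here = ≤-refl
  lipschitz s h bound {x} {y} (step {y = w} {k = j} e p) = ≤-trans (lipschitz s h bound p)
    (subst (j + h (kind w) ≤_) (+-suc j _) (+-monoʳ-≤ j (≤ᵇ⇒≤ _ _ (subst T (sym (bound _ _ e)) _))))

  T₁ = tree true
  T₂ = tree false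
  open Distance T₁ using () renaming (dist to d₁)
  open Distance T₂ using () renaming (dist to d₂)

  3≤d₁-vb : 3 ≤ d₁ v b
  3≤d₁-vb = subst₂ _≤_ (cong from-v kind-b) (trans (cong (λ k → d₁ v b + from-v k) kind-v) (+-identityʳ _))
    (lipschitz true from-v (allᵏ²-sound (link true) _ refl) (Distance.geodesic T₁ v b))
    where
    -- The distances from `v` in `T₁`, by kind.
    from-v : Kind → ℕ
    from-v kv = 0
    from-v ka = 1
    from-v kc = 2
    from-v km = 2
    from-v _  = 3

  4≤d₂-cv : 4 ≤ d₂ c v
  4≤d₂-cv = subst₂ _≤_ (cong from-c kind-v) (trans (cong (λ k → d₂ c v + from-c k) kind-c) (+-identityʳ _))
    (lipschitz false from-c (allᵏ²-sound (link false) _ refl) (Distance.geodesic T₂ c v))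
    where
    -- The distances from `c` in `T₂`, by kind.
    from-c : Kind → ℕ
    from-c kc = 0
    from-c ka = 1
    from-c km = 2
    from-c kv = 4
    from-c _  = 3

  -- Only `v` and `c` have depth two, and in `T₁` both are neighbours of `a`. As `T₁` has a pair at
  -- distance at least three and `T₂` one at distance at least four, no pair is diametral in both
  -- trees.
  short : ∀ x y → (d₁ x y ≤ 3 × d₂ x y ≤ 3) ⊎ d₁ x y ≤ 2
  short x y with deep (kind x) | deep (kind y)
  ... | inj₁ p | _      = inj₁ (bound true , bound false)
    where
    bound : ∀ s → Distance.dist (tree s) x y ≤ 3
    bound s = ≤-trans (Distance.dist≤ (tree s) (via-m s x y)) (+-mono-≤ p (depth≤2 (kind y)))
  ... | inj₂ _ | inj₁ p = inj₁ (bound true , bound false)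
    where
    bound : ∀ s → Distance.dist (tree s) x y ≤ 3
    bound s = ≤-trans (Distance.dist≤ (tree s) (via-m s x y)) (+-mono-≤ (depth≤2 (kind x)) p)
  ... | inj₂ p | inj₂ q = inj₂ (Distance.dist≤ T₁ (step (at-a p) (step (from-a q) here)))
    where
    at-a : ∀ {x} → kind x ≡ kv ⊎ kind x ≡ kc → adj (G true) x a ≡ true
    at-a (inj₁ e) = edge true e kind-a refl
    at-a (inj₂ e) = edge true e kind-a refl
    from-a : ∀ {x} → kind x ≡ kv ⊎ kind x ≡ kc → adj (G true) a x ≡ true
    from-a (inj₁ e) = edge true kind-a e refl
    from-a (inj₂ e) = edge true kind-a e refl

  module _ (Q : QueryGraph n) (Qa : adj Q v a ≡ false) (Qb : adj Q v b ≡ false) (Qc : adj Q v c ≡ false) where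

    private
      self : Consistent Q T₁ T₁
      self _ _ _ _ d = d

      isDist : ∀ {x y d} → (∀ {j} → Walk (G true) x y j → Walk (G false) x y j) →
               (∀ {j} → Walk (G false) x y j → Walk (G true) x y j) → IsDist T₁ x y d → IsDist T₂ x y d
      isDist to from (p , min) = to p , λ k q → min k (from q)

      v-fixed-b : v-at-b (kind v) ≡ kind v
      v-fixed-b = trans (cong v-at-b kind-v) (sym kind-v)

      v-fixed-a : v-at-a (kind v) ≡ kind v
      v-fixed-a = trans (cong v-at-a kind-v) (sym kind-v)

      at-v : ∀ {y} → adj Q v y ≡ true → v-at-b (kind y) ≡ kind y × v-at-a (kind y) ≡ kind y
      at-v {y} q with v-at-fixes (kind y)
      ... | inj₂ fix = fix
      ... | inj₁ (inj₁ e) with refl ← of-kind e with () ← trans (sym q) Qa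
      ... | inj₁ (inj₂ (inj₁ e)) with refl ← of-kind e with () ← trans (sym q) Qb
      ... | inj₁ (inj₂ (inj₂ e)) with refl ← of-kind e with () ← trans (sym q) Qc

    -- A queried pair without `v` is fixed by `drop-v`, which works in both directions. A queried
    -- pair with `v` has its other end outside `a`, `b` and `c`, so `v-at-b` and `v-at-a` fix it.
    consistent₁₂ : Consistent Q T₁ T₂
    consistent₁₂ x y q d with drop-v-fixes (kind x) | drop-v-fixes (kind y)
    ... | inj₂ fx | inj₂ fy = isDist (drop-v-walk true false fx fy) (drop-v-walk false true fx fy)
    ... | inj₁ e | _ with refl ← of-kind e with at-v q
    ...   | fb , fa = isDist (v-at-b-walk v-fixed-b fb) (v-at-a-walk v-fixed-a fa)
    consistent₁₂ x y q d | inj₂ _ | inj₁ e with refl ← of-kind e with at-v (trans (adj-sym Q v x) q)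
    ...   | fb , fa = isDist (v-at-b-walk fb v-fixed-b) (v-at-a-walk fa v-fixed-a)

    ¬findsMaxPair : ¬ FindsMaxPair Q
    ¬findsMaxPair finds with finds T₁
    ... | x , y , diam with short x y
    ...   | inj₁ (_ , le) = 1+n≰n (≤-trans 4≤d₂-cv (≤-trans
      (diam T₂ consistent₁₂ c v _ _ (Distance.isDist T₂ x y) (Distance.isDist T₂ c v)) le))
    ...   | inj₂ le = 1+n≰n (≤-trans 3≤d₁-vb (≤-trans
      (diam T₁ self v b _ _ (Distance.isDist T₁ x y) (Distance.isDist T₁ v b)) le))

    ¬determinesIso : ¬ DeterminesIso Q
    ¬determinesIso det = 1+n≰n (≤-trans 4≤d₂-cv
      (isomorphic-dist≤ {T = T₁} {T₂} (det T₁ T₁ T₂ self consistent₁₂) d₁≤3 c v))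
      where
      d₁≤3 : ∀ x y → d₁ x y ≤ 3
      d₁≤3 x y with short x y
      ... | inj₁ (le , _) = le
      ... | inj₂ le       = ≤-trans le (n≤1+n 2)

-- Degrees and numbers of queries

sum-allFin : ∀ {n} (F : Fin n → ℕ) → sum (map F (allFin n)) ≡ ∑ F
sum-allFin F = trans (cong sum (map-tabulate id F)) (sum-tabulate F)
  where
  sum-tabulate : ∀ {n} (F : Fin n → ℕ) → sum (tabulate F) ≡ ∑ F
  sum-tabulate {zero}  F = refl
  sum-tabulate {suc n} F = cong (F zero +_) (sum-tabulate (F ∘ suc))

∑-mono : ∀ {n} {F F′ : Fin n → ℕ} → (∀ i → F i ≤ F′ i) → ∑ F ≤ ∑ F′
∑-mono {zero}  le = z≤n
∑-mono {suc n} le = +-mono-≤ (le zero) (∑-mono (le ∘ suc))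

∑-const : ∀ n k → ∑ {n} (λ _ → k) ≡ n * k
∑-const zero    k = refl
∑-const (suc n) k = cong (k +_) (∑-const n k)

χ : Bool → ℕ
χ b = if b then 1 else 0

χ≤1 : ∀ b → χ b ≤ 1
χ≤1 true  = ≤-refl
χ≤1 false = z≤n

point : ∀ {n} → Fin n → Fin n → ℕ
point p u = χ (does (p ≟ u))

point-at : ∀ {n} (p : Fin n) → point p p ≡ 1
point-at p = cong χ (dec-true (p ≟ p) refl)

point-off : ∀ {n} {p u : Fin n} → p ≢ u → point p u ≡ 0
point-off {p = p} {u} p≢u = cong χ (dec-false (p ≟ u) p≢u)

∑-point : ∀ {n} (p : Fin n) → ∑ (point p) ≡ 1
∑-point {suc n} zero    = cong suc (sum-replicate-zero n)
∑-point {suc n} (suc p) = ∑-point p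

∑-add-point : ∀ {n} (F : Fin n → ℕ) p → ∑ (λ u → F u + point p u) ≡ suc (∑ F)
∑-add-point F p = trans (∑-distrib-+ F (point p)) (trans (cong (∑ F +_) (∑-point p)) (+-comm _ 1))

-- Induction on the list: raising `F` from zero to one at its first point keeps the hypotheses for
-- the tail and adds one to the sum.
zeros≤ : ∀ {n} {xs : List (Fin n)} {F : Fin n → ℕ} → Unique xs → (∀ u → F u ≤ 1) → (∀ {u} → u ∈ xs → F u ≡ 0) →
         ∑ F + length xs ≤ n
zeros≤ {n} {[]} {F} _ F≤1 _ = subst₂ _≤_ (sym (+-identityʳ _)) (trans (∑-const n 1) (*-identityʳ n)) (∑-mono F≤1)
zeros≤ {n} {x ∷ xs} {F} (x∉xs ∷ uniq) F≤1 F≡0 =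
  subst (_≤ n) (trans (cong (_+ length xs) (∑-add-point F x)) (sym (+-suc (∑ F) (length xs))))
    (zeros≤ uniq F′≤1 F′≡0)
  where
  F′≤1 : ∀ u → F u + point x u ≤ 1
  F′≤1 u with x ≟ u
  ... | yes refl = ≤-reflexive (cong (_+ 1) (F≡0 (here refl)))
  ... | no _     = subst (_≤ 1) (sym (+-identityʳ _)) (F≤1 u)
  F′≡0 : ∀ {u} → u ∈ xs → F u + point x u ≡ 0
  F′≡0 u∈ = cong₂ _+_ (F≡0 (there u∈)) (point-off (All.lookup x∉xs u∈))

≤zeros : ∀ {n} (xs : List (Fin n)) {F : Fin n → ℕ} → (∀ u → u ∈ xs ⊎ 1 ≤ F u) → n ≤ ∑ F + length xs
≤zeros {n} [] {F} cover = subst₂ _≤_ (trans (∑-const n 1) (*-identityʳ n)) (sym (+-identityʳ _)) (∑-mono 1≤F)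
  where
  1≤F : ∀ u → 1 ≤ F u
  1≤F u with cover u
  ... | inj₂ le = le
≤zeros {n} (x ∷ xs) {F} cover =
  subst (n ≤_) (trans (cong (_+ length xs) (∑-add-point F x)) (sym (+-suc (∑ F) (length xs)))) (≤zeros xs cover′)
  where
  cover′ : ∀ u → u ∈ xs ⊎ 1 ≤ F u + point x u
  cover′ u with cover u
  ... | inj₁ (here refl) = inj₂ (subst (λ k → 1 ≤ F u + k) (sym (point-at u)) (m≤n+m 1 (F u)))
  ... | inj₁ (there p)   = inj₁ p
  ... | inj₂ le          = inj₂ (≤-trans le (m≤m+n _ _))

module _ {n : ℕ} (Q : QueryGraph n) where

  degree-∑ : ∀ v → degree Q v ≡ ∑ (λ u → χ (adj Q v u))
  degree-∑ v = sum-allFin (λ u → χ (adj Q v u))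

  ¬adj⇒degree≤ : ∀ v {xs} → Unique xs → (∀ {u} → u ∈ xs → adj Q v u ≡ false) → degree Q v + length xs ≤ n
  ¬adj⇒degree≤ v {xs} uniq none = subst (λ d → d + length xs ≤ n) (sym (degree-∑ v))
    (zeros≤ uniq (λ u → χ≤1 _) (cong χ ∘ none))

  cover⇒≤degree : ∀ v xs → (∀ u → u ∈ xs ⊎ adj Q v u ≡ true) → n ≤ degree Q v + length xs
  cover⇒≤degree v xs cover = subst (λ d → n ≤ d + length xs) (sym (degree-∑ v)) (≤zeros xs λ u →
    [ inj₁ , (λ e → inj₂ (≤-reflexive (sym (cong χ e)))) ]′ (cover u))

  -- `numQueries` counts an edge once, at its ordered pair with `i < j`. Adding the transposed
  -- double sum counts it at both of its ends.
  handshake : numQueries Q * 2 ≡ ∑ (degree Q)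
  handshake = begin
    numQueries Q * 2                                       ≡⟨ *-comm (numQueries Q) 2 ⟩
    numQueries Q + (numQueries Q + 0)                      ≡⟨ cong (numQueries Q +_) (+-identityʳ _) ⟩
    numQueries Q + numQueries Q                            ≡⟨ cong₂ _+_ numQueries-∑ (trans numQueries-∑ (∑-comm ordered)) ⟩
    ∑ (λ i → ∑ (ordered i)) + ∑ (λ i → ∑ (λ j → ordered j i)) ≡⟨ ∑-distrib-+ (λ i → ∑ (ordered i)) _ ⟨
    ∑ (λ i → ∑ (ordered i) + ∑ (λ j → ordered j i))        ≡⟨ sum-cong-≗ (λ i → sym (∑-distrib-+ (ordered i) _)) ⟩
    ∑ (λ i → ∑ (λ j → ordered i j + ordered j i))          ≡⟨ sum-cong-≗ (λ i → sum-cong-≗ (λ j → both i j)) ⟩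
    ∑ (λ i → ∑ (λ j → χ (adj Q i j)))                      ≡⟨ sum-cong-≗ (λ i → sym (degree-∑ i)) ⟩
    ∑ (degree Q)                                           ∎
    where
    open ≡-Reasoning
    ordered : Fin n → Fin n → ℕ
    ordered i j = χ (adj Q i j ∧ (toℕ i <ᵇ toℕ j))
    numQueries-∑ : numQueries Q ≡ ∑ (λ i → ∑ (ordered i))
    numQueries-∑ = trans (sum-allFin (λ i → sum (map (ordered i) (allFin n)))) (sum-cong-≗ λ i → sum-allFin (ordered i))
    kept : ∀ i j → toℕ i < toℕ j → ordered i j ≡ χ (adj Q i j)
    kept i j lt = cong χ (trans (cong (adj Q i j ∧_) (dec-true (toℕ i <? toℕ j) lt)) (∧-identityʳ _))
    gone : ∀ i j → ¬ toℕ i < toℕ j → ordered i j ≡ 0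
    gone i j ¬lt = cong χ (trans (cong (adj Q i j ∧_) (dec-false (toℕ i <? toℕ j) ¬lt)) (∧-zeroʳ _))
    both : ∀ i j → ordered i j + ordered j i ≡ χ (adj Q i j)
    both i j with <-cmp (toℕ i) (toℕ j)
    ... | tri< lt _ ¬gt = trans (cong₂ _+_ (kept i j lt) (gone j i ¬gt)) (+-identityʳ _)
    ... | tri> ¬lt _ gt = trans (cong₂ _+_ (gone i j ¬lt) (kept j i gt)) (cong χ (adj-sym Q j i))
    ... | tri≈ ¬lt e ¬gt with refl ← toℕ-injective e =
      trans (cong₂ _+_ (gone i j ¬lt) (gone j i ¬gt)) (sym (cong χ (adj-irr Q i)))

  unqueried? : ∀ x y → Dec (Unqueried Q x y)
  unqueried? x y = ¬? (x ≟ y) ×-dec (adj Q x y ≟ᵇ false)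

  Unqueried≥3 : Fin n → Set
  Unqueried≥3 x = ∃[ a ] ∃[ b ] ∃[ c ]
    (Unqueried Q x a × (Unqueried Q x b × b ≢ a) × (Unqueried Q x c × c ≢ a × c ≢ b))

  unqueried≥3-or-≤2 : ∀ x → Unqueried≥3 x ⊎ Unqueried≤2 Q x
  unqueried≥3-or-≤2 x with any? (unqueried? x)
  ... | no none = inj₂ (x , x , λ y h → contradiction (y , h) none)
  ... | yes (a , ha) with any? (λ b → unqueried? x b ×-dec ¬? (b ≟ a))
  ...   | no none = inj₂ (a , a , λ y h →
            inj₁ (decidable-stable (y ≟ a) λ y≢a → none (y , h , y≢a)))
  ...   | yes (b , hb) with any? (λ c → unqueried? x c ×-dec (¬? (c ≟ a) ×-dec ¬? (c ≟ b)))
  ...     | yes (c , hc) = inj₁ (a , b , c , ha , hb , hc)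
  ...     | no none = inj₂ (a , b , λ y h → decidable-stable ((y ≟ a) ⊎-dec (y ≟ b))
              λ ne → none (y , h , ne ∘ inj₁ , ne ∘ inj₂))

  bounded⇒minDegree : (∀ x → Unqueried≤2 Q x) → MinDegreeAtLeast Q (n ∸ 3)
  bounded⇒minDegree bounded v with bounded v
  ... | p , q , cover = m≤n+o⇒m∸n≤o n 3 (subst (n ≤_) (+-comm _ 3) (cover⇒≤degree v (v ∷ p ∷ q ∷ []) member))
    where
    member : ∀ u → u ∈ v ∷ p ∷ q ∷ [] ⊎ adj Q v u ≡ true
    member u with unqueried? v u
    ... | yes h = inj₁ (there ([ here , there ∘ here ]′ (cover u h)))
    ... | no ¬h with v ≟ u
    ...   | yes e = inj₁ (here (sym e))
    ...   | no v≢u = inj₂ (¬-not λ e → ¬h (v≢u , e))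

  minDegree⇒bounded : MinDegreeAtLeast Q (n ∸ 3) → ∀ x → Unqueried≤2 Q x
  minDegree⇒bounded deg x with unqueried≥3-or-≤2 x
  ... | inj₂ bounded = bounded
  ... | inj₁ (a , b , c , (x≢a , xa) , ((x≢b , xb) , b≢a) , ((x≢c , xc) , c≢a , c≢b)) =
    contradiction (≤-trans (m+n≤o⇒m≤o∸n (suc (degree Q x)) few) (deg x)) 1+n≰n
    where
    few : suc (degree Q x) + 3 ≤ n
    few = subst (_≤ n) (+-suc (degree Q x) 3) (¬adj⇒degree≤ x {x ∷ a ∷ b ∷ c ∷ []}
      ((x≢a ∷ x≢b ∷ x≢c ∷ []) ∷ ((b≢a ∘ sym) ∷ (c≢a ∘ sym) ∷ []) ∷ ((c≢b ∘ sym) ∷ []) ∷ [] ∷ [])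
      λ { (here refl) → adj-irr Q x ; (there (here refl)) → xa ; (there (there (here refl))) → xb
        ; (there (there (there (here refl)))) → xc })

  -- `P` stands for either of the two properties of `Q`. Three unqueried partners of a vertex,
  -- together with a fifth vertex `m` as root, are the data of `Ambiguous`.
  bounded-unless-ambiguous : 13 ≤ n → {P : Set} → P →
    (∀ {v a b c m : Fin n} → v ≢ a → v ≢ b → v ≢ c → v ≢ m → a ≢ b → a ≢ c → a ≢ m → b ≢ c → b ≢ m → c ≢ m →
       adj Q v a ≡ false → adj Q v b ≡ false → adj Q v c ≡ false → ¬ P) →
    ∀ x → Unqueried≤2 Q x
  bounded-unless-ambiguous 13≤n p refute x with unqueried≥3-or-≤2 x
  ... | inj₂ bounded = bounded
  ... | inj₁ (a , b , c , (x≢a , xa) , ((x≢b , xb) , b≢a) , ((x≢c , xc) , c≢a , c≢b))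
    with fresh (x ∷ a ∷ b ∷ c ∷ []) (≤-trans (s≤s (s≤s (s≤s (s≤s (s≤s z≤n))))) 13≤n)
  ...   | m , m∉ = contradiction p (refute x≢a x≢b x≢c (λ e → m∉ (here (sym e))) (b≢a ∘ sym) (c≢a ∘ sym)
                     (λ e → m∉ (there (here (sym e)))) (c≢b ∘ sym) (λ e → m∉ (there (there (here (sym e)))))
                     (λ e → m∉ (there (there (there (here (sym e)))))) xa xb xc)

  findsMaxPair⇒bounded : 13 ≤ n → FindsMaxPair Q → ∀ x → Unqueried≤2 Q x
  findsMaxPair⇒bounded 13≤n finds = bounded-unless-ambiguous 13≤n finds
    λ va vb vc vm ab ac am bc bm cm → Ambiguous.¬findsMaxPair va vb vc vm ab ac am bc bm cm Q

  determinesIso⇒bounded : 13 ≤ n → DeterminesIso Q → ∀ x → Unqueried≤2 Q x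
  determinesIso⇒bounded 13≤n det = bounded-unless-ambiguous 13≤n det
    λ va vb vc vm ab ac am bc bm cm → Ambiguous.¬determinesIso va vb vc vm ab ac am bc bm cm Q

  minDegree⇒numQueries≥ : ∀ {k} → MinDegreeAtLeast Q k → (n * k) / 2 ≤ numQueries Q
  minDegree⇒numQueries≥ {k} deg = subst ((n * k) / 2 ≤_) (m*n/n≡m (numQueries Q) 2)
    (/-monoˡ-≤ 2 (subst₂ _≤_ (∑-const n k) (sym handshake) (∑-mono deg)))

  regular⇒numQueries : ∀ {k} → (∀ v → degree Q v ≡ k) → numQueries Q ≡ (n * k) / 2
  regular⇒numQueries {k} deg = trans (sym (m*n/n≡m (numQueries Q) 2))
    (cong (_/ 2) (trans handshake (trans (sum-cong-≗ deg) (∑-const n k))))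

-- An extremal query graph: the complement of a Hamiltonian cycle

module CycleComplement (l : ℕ) where

  private
    n : ℕ
    -- From three vertices on, `v`, `next v` and `prev v` are distinct, so the complement of the
    -- cycle has all degrees equal to `n ∸ 3`.
    n = suc (suc (suc l))

  next : Fin n → Fin n
  next i with view i
  ... | ‵fromℕ     = zero
  ... | ‵inject₁ j = suc j

  prev : Fin n → Fin n
  prev zero    = fromℕ _
  prev (suc j) = inject₁ j

  next-prev : ∀ i → next (prev i) ≡ i
  next-prev zero    rewrite view-fromℕ (suc (suc l)) = refl
  next-prev (suc j) rewrite view-inject₁ j = refl

  prev-next : ∀ i → prev (next i) ≡ i
  prev-next i with view i
  ... | ‵fromℕ     = refl
  ... | ‵inject₁ j = refl

  next≢ : ∀ i → next i ≢ i
  next≢ i e with view i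
  ... | ‵inject₁ j = grows 0 (sym (trans (cong toℕ e) (toℕ-inject₁ j)))

  prev≢ : ∀ i → prev i ≢ i
  prev≢ i e = next≢ i (trans (cong next (sym e)) (next-prev i))

  next≢prev : ∀ i → next i ≢ prev i
  next≢prev (suc i) e with view i
  ... | ‵inject₁ j = grows 1 (sym (trans (cong toℕ e) (trans (toℕ-inject₁ _) (toℕ-inject₁ j))))

  Near : Fin n → Fin n → Set
  Near i j = i ≡ j ⊎ next i ≡ j ⊎ next j ≡ i

  near? : ∀ i j → Dec (Near i j)
  near? i j = (i ≟ j) ⊎-dec (next i ≟ j) ⊎-dec (next j ≟ i)

  near-sym : ∀ {i j} → Near i j → Near j i
  near-sym (inj₁ e)        = inj₁ (sym e)
  near-sym (inj₂ (inj₁ e)) = inj₂ (inj₂ e)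
  near-sym (inj₂ (inj₂ e)) = inj₂ (inj₁ e)

  complement : QueryGraph n
  complement = record
    { adj     = λ i j → not (does (near? i j))
    ; adj-sym = λ i j → cong not (does-⇔ (mk⇔ near-sym near-sym) (near? i j) (near? j i))
    ; adj-irr = λ i → cong not (dec-true (near? i i) (inj₁ refl)) }

  degree-complement : ∀ v → degree complement v ≡ n ∸ 3
  degree-complement v = ≤-antisym
    (m+n≤o⇒m≤o∸n _ (¬adj⇒degree≤ complement v {xs}
      (((next≢ v ∘ sym) ∷ (prev≢ v ∘ sym) ∷ []) ∷ (next≢prev v ∷ []) ∷ [] ∷ []) (cong not ∘ dec-true (near? v _) ∘ near)))
    (m≤n+o⇒m∸n≤o n 3 (subst (n ≤_) (+-comm _ 3) (cover⇒≤degree complement v xs far)))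
    where
    xs = v ∷ next v ∷ prev v ∷ []
    near : ∀ {u} → u ∈ xs → Near v u
    near (here e)                 = inj₁ (sym e)
    near (there (here e))         = inj₂ (inj₁ (sym e))
    near (there (there (here e))) = inj₂ (inj₂ (trans (cong next e) (next-prev v)))
    far : ∀ u → u ∈ xs ⊎ adj complement v u ≡ true
    far u with near? v u
    ... | yes (inj₁ e)        = inj₁ (here (sym e))
    ... | yes (inj₂ (inj₁ e)) = inj₁ (there (here (sym e)))
    ... | yes (inj₂ (inj₂ e)) = inj₁ (there (there (here (trans (sym (prev-next u)) (cong prev e)))))
    ... | no ¬near            = inj₂ (cong not (dec-false (near? v u) ¬near))

regular-graph : ∀ n → 3 ≤ n → Σ (QueryGraph n) λ Q → ∀ v → degree Q v ≡ n ∸ 3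
regular-graph (suc (suc (suc l))) (s≤s (s≤s (s≤s _))) = complement , degree-complement
  where open CycleComplement l

theorem2p4 : ∀ (n : ℕ) → 13 ≤ n →
    IsMinQueries {n} FindsMaxPair ((n * (n ∸ 3)) / 2)
    × IsMinQueries {n} DeterminesIso ((n * (n ∸ 3)) / 2)
    × (∀ (Q : QueryGraph n) →
    (FindsMaxPair Q ⇔ DeterminesIso Q)
    × (DeterminesIso Q ⇔ MinDegreeAtLeast Q (n ∸ 3)))
theorem2p4 n 13≤n =
  ( (Q₀ , findsMaxPair 13≤n Q₀ bounded₀ , regular⇒numQueries Q₀ degree₀)
  , λ Q finds → minDegree⇒numQueries≥ Q (bounded⇒minDegree Q (findsMaxPair⇒bounded Q 13≤n finds)) ) ,
  ( (Q₀ , determinesIso 13≤n Q₀ bounded₀ , regular⇒numQueries Q₀ degree₀)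
  , λ Q det → minDegree⇒numQueries≥ Q (bounded⇒minDegree Q (determinesIso⇒bounded Q 13≤n det)) ) ,
  λ Q → mk⇔ (λ finds → determinesIso 13≤n Q (findsMaxPair⇒bounded Q 13≤n finds))
            (λ det → findsMaxPair 13≤n Q (determinesIso⇒bounded Q 13≤n det)) ,
        mk⇔ (λ det → bounded⇒minDegree Q (determinesIso⇒bounded Q 13≤n det))
            (λ deg → determinesIso 13≤n Q (minDegree⇒bounded Q deg))
  where
  Q₀ = proj₁ (regular-graph n (≤-trans (s≤s (s≤s (s≤s z≤n))) 13≤n))
  degree₀ : ∀ v → degree Q₀ v ≡ n ∸ 3
  degree₀ = proj₂ (regular-graph n (≤-trans (s≤s (s≤s (s≤s z≤n))) 13≤n))
  bounded₀ : ∀ x → Unqueried≤2 Q₀ x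
  bounded₀ = minDegree⇒bounded Q₀ (λ v → ≤-reflexive (sym (degree₀ v)))
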